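{- Assume that $\mathbf{r}=(r_0,r_1)\in\mathbb{R}^2$ is contained in one of the following sets: (i) $\{(r_0,r_1)\in\mathbb{R}^2 \mid r_0>0,\ r_1\le -2\sqrt{r_0},\ r_0+r_1\ge 0\}$; (ii) $\{(r_0,r_1)\in\mathbb{R}^2 \mid r_0+r_1\le -2,\ r_0-r_1\ne -1\}\setminus\{(r_0,r_1)\in\mathbb{R}^2 \mid r_0>-2,\ r_1>-1\}$; (iii) $\{(r_0,r_1)\in\mathbb{R}^2 \mid r_0+r_1\ge 0,\ r_0<0,\ r_1\ge 1\}$. Then $\mathbf{r}\in\mathcal{D}_2^{(*)}$.
   Context: For $\mathbf{r}=(r_0,r_1)\in\mathbb{R}^2$, the two-dimensional shift radix system is the map $\tau_{\mathbf{r}}:\mathbb{Z}^2\to\mathbb{Z}^2$, $\tau_{\mathbf{r}}(a_0,a_1)=(a_1,-\lfloor r_0a_0+r_1a_1\rfloor)$. The orbit of $(a_0,a_1)$ is identified with the integer sequence $(a_n)_{n\ge 0}$ where $a_{n+2}=-\lfloor r_0a_n+r_1a_{n+1}\rfloor$ for $n\ge0$. An orbit is ultimately periodic if there are $n_0\ge 0$, $p>0$ with $a_{n+p}=a_n$ for all $n\ge n_0$; it ends up in the trivial cycle if $a_n=0$ for all sufficiently large $n$. $\mathcal{D}_2^{(*)}$ is the set of all $\mathbf{r}\in\mathbb{R}^2$ such that each ultimately periodic orbit of $\tau_{\mathbf{r}}$ ends up in the trivial cycle. -}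

module Defs where

open import Data.Integer as ℤ using (ℤ; +_)
open import Data.Nat as ℕ using (ℕ; suc; _⊔_)
import Data.Nat.Properties as ℕ
open import Data.Product using (Σ-syntax; ∃-syntax; _×_; _,_)
open import Data.Rational as ℚ using (ℚ; 0ℚ; 1ℚ; ½; ∣_∣)
import Data.Rational.Properties as ℚ
open import Data.Rational.Solver using (module +-*-Solver)
open import Relation.Binary.PropositionalEquality
  using (_≡_; refl; sym; trans; cong; cong₂; subst)
open import Relation.Nullary using (¬_)

open +-*-Solver using (solve; _:=_; _:+_; _:*_; _:-_; :-_; con)

infix  4 _≈_ _<_ _≤_
infixl 6 _+_ _-_
infixl 7 _*_
infix  8 -_

-- Real numbers are Cauchy sequences of rationals, compared by the setoid
-- equality _≈_ below; the field operations act termwise.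

Eventually : (ℕ → Set) → Set
Eventually P = ∃[ N ] (∀ n → N ℕ.≤ n → P n)

IsCauchy : (ℕ → ℚ) → Set
IsCauchy x = ∀ ε → 0ℚ ℚ.< ε →
  ∃[ N ] (∀ m n → N ℕ.≤ m → N ℕ.≤ n → ∣ x m ℚ.- x n ∣ ℚ.< ε)

record ℝ : Set where
  constructor mkℝ
  field
    seq    : ℕ → ℚ
    cauchy : IsCauchy seq

open ℝ public

_≈_ : ℝ → ℝ → Set
x ≈ y = ∀ ε → 0ℚ ℚ.< ε → Eventually λ n → ∣ seq x n ℚ.- seq y n ∣ ℚ.< ε

_<_ : ℝ → ℝ → Set
x < y = Σ[ ε ∈ ℚ ] 0ℚ ℚ.< ε × Eventually λ n → seq x n ℚ.+ ε ℚ.≤ seq y n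

_≤_ : ℝ → ℝ → Set
x ≤ y = ∀ ε → 0ℚ ℚ.< ε → Eventually λ n → seq x n ℚ.≤ seq y n ℚ.+ ε

abstract private
  half-pos : ∀ {ε} → 0ℚ ℚ.< ε → 0ℚ ℚ.< ½ ℚ.* ε
  half-pos {ε} 0<ε = subst (ℚ._< ½ ℚ.* ε) (ℚ.*-zeroʳ ½) (ℚ.*-monoʳ-<-pos ½ 0<ε)

  half+half : ∀ ε → ½ ℚ.* ε ℚ.+ ½ ℚ.* ε ≡ ε
  half+half = solve 1 (λ e → con ½ :* e :+ con ½ :* e := e) refl

  +-cauchy : ∀ {x y} → IsCauchy x → IsCauchy y → IsCauchy (λ n → x n ℚ.+ y n)
  +-cauchy {x} {y} cx cy ε 0<ε with cx (½ ℚ.* ε) (half-pos 0<ε) | cy (½ ℚ.* ε) (half-pos 0<ε)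
  ... | M , px | N , py = M ⊔ N , λ m n hm hn → begin-strict
    ∣ (x m ℚ.+ y m) ℚ.- (x n ℚ.+ y n) ∣
      ≡⟨ cong ∣_∣ (rearrange (x m) (y m) (x n) (y n)) ⟩
    ∣ (x m ℚ.- x n) ℚ.+ (y m ℚ.- y n) ∣
      ≤⟨ ℚ.∣p+q∣≤∣p∣+∣q∣ (x m ℚ.- x n) (y m ℚ.- y n) ⟩
    ∣ x m ℚ.- x n ∣ ℚ.+ ∣ y m ℚ.- y n ∣
      <⟨ ℚ.+-mono-< (px m n (ℕ.m⊔n≤o⇒m≤o M N hm) (ℕ.m⊔n≤o⇒m≤o M N hn))
                    (py m n (ℕ.m⊔n≤o⇒n≤o M N hm) (ℕ.m⊔n≤o⇒n≤o M N hn)) ⟩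
    ½ ℚ.* ε ℚ.+ ½ ℚ.* ε
      ≡⟨ half+half ε ⟩
    ε ∎
    where
    open ℚ.≤-Reasoning
    rearrange : ∀ a b c d → (a ℚ.+ b) ℚ.- (c ℚ.+ d) ≡ (a ℚ.- c) ℚ.+ (b ℚ.- d)
    rearrange = solve 4 (λ a b c d → (a :+ b) :- (c :+ d) := (a :- c) :+ (b :- d)) refl

  neg-cauchy : ∀ {x} → IsCauchy x → IsCauchy (λ n → ℚ.- x n)
  neg-cauchy {x} cx ε 0<ε with cx ε 0<ε
  ... | N , px = N , λ m n hm hn → subst (ℚ._< ε)
    (trans (sym (ℚ.∣-p∣≡∣p∣ (x m ℚ.- x n))) (cong ∣_∣ (flip (x m) (x n)))) (px m n hm hn)
    where
    flip : ∀ a b → ℚ.- (a ℚ.- b) ≡ (ℚ.- a) ℚ.- (ℚ.- b)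
    flip = solve 2 (λ a b → :- (a :- b) := (:- a) :- (:- b)) refl

  const-cauchy : ∀ q → IsCauchy (λ _ → q)
  const-cauchy q ε 0<ε = 0 , λ _ _ _ _ →
    subst (ℚ._< ε) (sym (cong ∣_∣ (ℚ.+-inverseʳ q))) 0<ε

  bounded : ∀ {x} → IsCauchy x →
    Σ[ B ∈ ℚ ] 0ℚ ℚ.≤ B × Eventually λ n → ∣ x n ∣ ℚ.≤ B
  bounded {x} cx with cx 1ℚ (ℚ.positive⁻¹ 1ℚ)
  ... | N , px = 1ℚ ℚ.+ ∣ x N ∣ , 0≤B , N , λ n hn → begin
    ∣ x n ∣
      ≡⟨ cong ∣_∣ (split (x n) (x N)) ⟩
    ∣ (x n ℚ.- x N) ℚ.+ x N ∣
      ≤⟨ ℚ.∣p+q∣≤∣p∣+∣q∣ (x n ℚ.- x N) (x N) ⟩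
    ∣ x n ℚ.- x N ∣ ℚ.+ ∣ x N ∣
      ≤⟨ ℚ.+-monoˡ-≤ ∣ x N ∣ (ℚ.<⇒≤ (px n N hn ℕ.≤-refl)) ⟩
    1ℚ ℚ.+ ∣ x N ∣ ∎
    where
    open ℚ.≤-Reasoning
    split : ∀ a b → a ≡ (a ℚ.- b) ℚ.+ b
    split = solve 2 (λ a b → a := (a :- b) :+ b) refl
    0≤B : 0ℚ ℚ.≤ 1ℚ ℚ.+ ∣ x N ∣
    0≤B = ℚ.+-mono-≤ (ℚ.nonNegative⁻¹ 1ℚ) (ℚ.0≤∣p∣ (x N))

  common-bound : ∀ A B → 0ℚ ℚ.≤ A → 0ℚ ℚ.≤ B →
    Σ[ C ∈ ℚ ] 0ℚ ℚ.< C × A ℚ.≤ C × B ℚ.≤ C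
  common-bound A B 0≤A 0≤B =
    1ℚ ℚ.+ (A ℚ.+ B) ,
    ℚ.+-mono-<-≤ (ℚ.positive⁻¹ 1ℚ) (ℚ.+-mono-≤ 0≤A 0≤B) ,
    (begin
      A                     ≡⟨ ℚ.+-identityʳ A ⟨
      A ℚ.+ 0ℚ              ≤⟨ ℚ.+-monoʳ-≤ A 0≤B ⟩
      A ℚ.+ B               ≤⟨ below ⟩
      1ℚ ℚ.+ (A ℚ.+ B)      ∎) ,
    (begin
      B                     ≡⟨ ℚ.+-identityˡ B ⟨
      0ℚ ℚ.+ B              ≤⟨ ℚ.+-monoˡ-≤ B 0≤A ⟩
      A ℚ.+ B               ≤⟨ below ⟩
      1ℚ ℚ.+ (A ℚ.+ B)      ∎)
    where
    open ℚ.≤-Reasoning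
    below : A ℚ.+ B ℚ.≤ 1ℚ ℚ.+ (A ℚ.+ B)
    below = begin
      A ℚ.+ B               ≡⟨ ℚ.+-identityˡ (A ℚ.+ B) ⟨
      0ℚ ℚ.+ (A ℚ.+ B)      ≤⟨ ℚ.+-monoˡ-≤ (A ℚ.+ B) (ℚ.nonNegative⁻¹ 1ℚ) ⟩
      1ℚ ℚ.+ (A ℚ.+ B)      ∎

  shrink : ∀ C η → 0ℚ ℚ.< C → 0ℚ ℚ.< η → Σ[ δ ∈ ℚ ] 0ℚ ℚ.< δ × C ℚ.* δ ≡ η
  shrink C η 0<C 0<η = 1/C ℚ.* η ,
    subst (ℚ._< 1/C ℚ.* η) (ℚ.*-zeroʳ 1/C)
      (ℚ.*-monoʳ-<-pos 1/C {{ℚ.1/pos⇒pos C {{C-pos}}}} 0<η) ,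
    trans (sym (ℚ.*-assoc C 1/C η))
      (trans (cong (ℚ._* η) (ℚ.*-inverseʳ C {{C-nonZero}})) (ℚ.*-identityˡ η))
    where
    C-pos : ℚ.Positive C
    C-pos = ℚ.positive 0<C
    C-nonZero : ℚ.NonZero C
    C-nonZero = ℚ.pos⇒nonZero C {{C-pos}}
    1/C : ℚ
    1/C = ℚ.1/_ C {{C-nonZero}}

  scale : ∀ C δ p q → 0ℚ ℚ.< C → ∣ p ∣ ℚ.≤ C → ∣ q ∣ ℚ.< δ → ∣ p ℚ.* q ∣ ℚ.< C ℚ.* δ
  scale C δ p q 0<C hp hq = begin-strict
    ∣ p ℚ.* q ∣        ≡⟨ ℚ.∣p*q∣≡∣p∣*∣q∣ p q ⟩
    ∣ p ∣ ℚ.* ∣ q ∣    ≤⟨ ℚ.*-monoʳ-≤-nonNeg ∣ q ∣ {{ℚ.∣-∣-nonNeg q}} hp ⟩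
    C ℚ.* ∣ q ∣        <⟨ ℚ.*-monoʳ-<-pos C {{ℚ.positive 0<C}} hq ⟩
    C ℚ.* δ            ∎
    where open ℚ.≤-Reasoning

  rearrange : ∀ a b c d → a ℚ.* b ℚ.- c ℚ.* d ≡ a ℚ.* (b ℚ.- d) ℚ.+ d ℚ.* (a ℚ.- c)
  rearrange = solve 4 (λ a b c d → a :* b :- c :* d := a :* (b :- d) :+ d :* (a :- c)) refl

  product-close : ∀ C δ a b c d → 0ℚ ℚ.< C → ∣ a ∣ ℚ.≤ C → ∣ d ∣ ℚ.≤ C →
    ∣ a ℚ.- c ∣ ℚ.< δ → ∣ b ℚ.- d ∣ ℚ.< δ →
    ∣ a ℚ.* b ℚ.- c ℚ.* d ∣ ℚ.< C ℚ.* δ ℚ.+ C ℚ.* δ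
  product-close C δ a b c d 0<C ha hd hac hbd =
    subst (λ t → ∣ t ∣ ℚ.< C ℚ.* δ ℚ.+ C ℚ.* δ) (sym (rearrange a b c d))
      (ℚ.≤-<-trans (ℚ.∣p+q∣≤∣p∣+∣q∣ (a ℚ.* (b ℚ.- d)) (d ℚ.* (a ℚ.- c)))
        (ℚ.+-mono-< (scale C δ a (b ℚ.- d) 0<C ha hbd) (scale C δ d (a ℚ.- c) 0<C hd hac)))

  *-cauchy : ∀ {x y} → IsCauchy x → IsCauchy y → IsCauchy (λ n → x n ℚ.* y n)
  *-cauchy {x} {y} cx cy ε 0<ε =
    let A , 0≤A , K , bx = bounded {x} cx
        B , 0≤B , L , by = bounded {y} cy
        C , 0<C , A≤C , B≤C = common-bound A B 0≤A 0≤B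
        δ , 0<δ , Cδ≡½ε = shrink C (½ ℚ.* ε) 0<C (half-pos 0<ε)
        M , px = cx δ 0<δ
        N , py = cy δ 0<δ
    in (K ⊔ L) ⊔ (M ⊔ N) , λ m n hm hn →
    let KL≤m = ℕ.m⊔n≤o⇒m≤o (K ⊔ L) (M ⊔ N) hm
        KL≤n = ℕ.m⊔n≤o⇒m≤o (K ⊔ L) (M ⊔ N) hn
        MN≤m = ℕ.m⊔n≤o⇒n≤o (K ⊔ L) (M ⊔ N) hm
        MN≤n = ℕ.m⊔n≤o⇒n≤o (K ⊔ L) (M ⊔ N) hn
    in subst (∣ x m ℚ.* y m ℚ.- x n ℚ.* y n ∣ ℚ.<_)
      (trans (cong₂ ℚ._+_ Cδ≡½ε Cδ≡½ε) (half+half ε))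
      (product-close C δ (x m) (y m) (x n) (y n) 0<C
        (ℚ.≤-trans (bx m (ℕ.m⊔n≤o⇒m≤o K L KL≤m)) A≤C)
        (ℚ.≤-trans (by n (ℕ.m⊔n≤o⇒n≤o K L KL≤n)) B≤C)
        (px m n (ℕ.m⊔n≤o⇒m≤o M N MN≤m) (ℕ.m⊔n≤o⇒m≤o M N MN≤n))
        (py m n (ℕ.m⊔n≤o⇒n≤o M N MN≤m) (ℕ.m⊔n≤o⇒n≤o M N MN≤n)))

fromℤ : ℤ → ℝ
fromℤ k = mkℝ (λ _ → k ℚ./ 1) (const-cauchy (k ℚ./ 1))

0ℝ 1ℝ 2ℝ : ℝ
0ℝ = fromℤ (+ 0)
1ℝ = fromℤ (+ 1)
2ℝ = fromℤ (+ 2)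

_+_ : ℝ → ℝ → ℝ
x + y = mkℝ (λ n → seq x n ℚ.+ seq y n) (+-cauchy {seq x} {seq y} (cauchy x) (cauchy y))

-_ : ℝ → ℝ
- x = mkℝ (λ n → ℚ.- seq x n) (neg-cauchy {seq x} (cauchy x))

_-_ : ℝ → ℝ → ℝ
x - y = x + (- y)

_*_ : ℝ → ℝ → ℝ
x * y = mkℝ (λ n → seq x n ℚ.* seq y n) (*-cauchy {seq x} {seq y} (cauchy x) (cauchy y))

-- s = √x
IsSqrt : ℝ → ℝ → Set
IsSqrt x s = 0ℝ ≤ s × s * s ≈ x

-- k = ⌊x⌋.  The floor is given by its graph, since it is not computable as a
-- function on Cauchy reals; classically k exists for every x and is unique.
IsFloor : ℝ → ℤ → Set
IsFloor x k = fromℤ k ≤ x × x < fromℤ (k ℤ.+ + 1)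

-- The graph of the shift radix system: Shift r v w means τ_r(v) = w.
Shift : ℝ × ℝ → ℤ × ℤ → ℤ × ℤ → Set
Shift (r₀ , r₁) (a₀ , a₁) (b₀ , b₁) =
  b₀ ≡ a₁ ×
  (∃[ k ] IsFloor (r₀ * fromℤ a₀ + r₁ * fromℤ a₁) k × b₁ ≡ ℤ.- k)

IsOrbit : ℝ × ℝ → (ℕ → ℤ) → Set
IsOrbit r a = ∀ n → Shift r (a n , a (suc n)) (a (suc n) , a (suc (suc n)))

UltimatelyPeriodic : (ℕ → ℤ) → Set
UltimatelyPeriodic a =
  ∃[ n₀ ] ∃[ p ] (0 ℕ.< p × (∀ n → n₀ ℕ.≤ n → a (n ℕ.+ p) ≡ a n))

EndsInTrivialCycle : (ℕ → ℤ) → Set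
EndsInTrivialCycle a = Eventually λ n → a n ≡ + 0

𝒟₂⁽*⁾ : ℝ × ℝ → Set
𝒟₂⁽*⁾ r = ∀ a → IsOrbit r a → UltimatelyPeriodic a → EndsInTrivialCycle a

-- With residual n = r₀ f n + r₁ f (n + 1) + f (n + 2), the orbits are the integer sequences
-- with 0 ≤ residual < 1, and a periodic one is examined at its extremal entries.  Since
-- f n ≡ 0 is decidable, extrema and order dichotomies on the reals may be used up to ¬¬.
-- In (i), and in (ii) when r₀ ≥ 0 or r₁ ≥ 0, a maximum principle gives max f < 1, and
-- applied to - f it gives min f > -1.  In (ii) with r₀, r₁ ≤ 0, two consecutive entries of the
-- same weak sign force f = 0, and otherwise the signs alternate: in the recurrence for ∣f∣ the
-- residuals then enter with alternating signs, so that for r₀ - r₁ ≠ -1 they cannot all have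
-- the sign required at an extremum of ∣f∣ and at its successor.
-- In (iii) a positive maximum leads to a state from which ∣f∣ grows forever, while if
-- all entries are ≤ 0, a negative minimum would be preceded by itself yet followed by 0.

module Submission where

open import Data.Integer as ℤ using (ℤ; +_; +0)
import Data.Integer.Properties as ℤ
open import Data.Nat as ℕ using (ℕ; zero; suc; _⊔_)
import Data.Nat.DivMod as ℕ
import Data.Nat.Properties as ℕ
open import Data.Product using (Σ-syntax; ∃-syntax; _×_; _,_; proj₁; proj₂)
open import Data.Rational as ℚ using (ℚ; 0ℚ; 1ℚ; ½; ∣_∣)
import Data.Rational.Properties as ℚ
open import Data.Rational.Solver using (module +-*-Solver)
open import Data.Rational.Unnormalised as ℚᵘ using (mkℚᵘ; *≡*; *≤*)
import Data.Rational.Unnormalised.Properties as ℚᵘ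
open import Data.Sum using (_⊎_; inj₁; inj₂; [_,_]′)
open import Function using (flip)
open import Relation.Binary.PropositionalEquality
  using (_≡_; _≢_; refl; sym; trans; cong; cong₂; subst; subst₂; module ≡-Reasoning)
open import Relation.Nullary using (¬_; yes; no)
open import Relation.Nullary.Decidable using (decidable-stable)
open import Defs

open +-*-Solver using (solve; _:=_; _:+_; _:*_; _:-_; :-_; con)

-- Rational numbers

2ℚ : ℚ
2ℚ = + 2 ℚ./ 1

*-nonNegℚ : ∀ {p q} → 0ℚ ℚ.≤ p → 0ℚ ℚ.≤ q → 0ℚ ℚ.≤ p ℚ.* q
*-nonNegℚ {p} {q} 0≤p 0≤q = ℚ.nonNegative⁻¹ (p ℚ.* q)
  {{ℚ.nonNeg*nonNeg⇒nonNeg p {{ℚ.nonNegative 0≤p}} q {{ℚ.nonNegative 0≤q}}}}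

half-pos : ∀ {ε} → 0ℚ ℚ.< ε → 0ℚ ℚ.< ½ ℚ.* ε
half-pos {ε} 0<ε = ℚ.positive⁻¹ (½ ℚ.* ε) {{ℚ.pos*pos⇒pos ½ ε {{ℚ.positive 0<ε}}}}

half+half : ∀ ε → ½ ℚ.* ε ℚ.+ ½ ℚ.* ε ≡ ε
half+half = solve 1 (λ e → con ½ :* e :+ con ½ :* e := e) refl

p≤∣p∣ : ∀ p → p ℚ.≤ ∣ p ∣
p≤∣p∣ p with ℚ.≤-total 0ℚ p
... | inj₁ 0≤p = ℚ.≤-reflexive (sym (ℚ.0≤p⇒∣p∣≡p 0≤p))
... | inj₂ p≤0 = ℚ.≤-trans p≤0 (ℚ.0≤∣p∣ p)

∣p∣<q⇒-q<p : ∀ {p q} → ∣ p ∣ ℚ.< q → ℚ.- q ℚ.< p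
∣p∣<q⇒-q<p {p} {q} h = subst (ℚ.- q ℚ.<_) (solve 1 (λ p → :- (:- p) := p) refl p)
  (ℚ.neg-antimono-< (ℚ.≤-<-trans (subst (ℚ.- p ℚ.≤_) (ℚ.∣-p∣≡∣p∣ p) (p≤∣p∣ (ℚ.- p))) h))

-- A factor that dips to `- δ`, against a factor of at most `C`, costs at most `C δ`; if both
-- factors are negative, the product is not. This is the termwise estimate behind `_⊗_`.
product-lower-bound : ∀ C δ x y → 0ℚ ℚ.≤ δ → 0ℚ ℚ.≤ x ℚ.+ δ → 0ℚ ℚ.≤ y ℚ.+ δ →
  0ℚ ℚ.≤ C ℚ.- x → 0ℚ ℚ.≤ C ℚ.- y → 0ℚ ℚ.≤ C → 0ℚ ℚ.≤ x ℚ.* y ℚ.+ C ℚ.* δ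
product-lower-bound C δ x y 0≤δ hx hy x≤C y≤C 0≤C with ℚ.≤-total 0ℚ y | ℚ.≤-total 0ℚ x
... | inj₁ 0≤y | _ = subst (0ℚ ℚ.≤_)
  (solve 4 (λ C d x y → (x :+ d) :* y :+ (C :- y) :* d := x :* y :+ C :* d) refl C δ x y)
  (ℚ.+-mono-≤ (*-nonNegℚ hx 0≤y) (*-nonNegℚ y≤C 0≤δ))
... | inj₂ y≤0 | inj₁ 0≤x = subst (0ℚ ℚ.≤_)
  (solve 4 (λ C d x y → (y :+ d) :* x :+ (C :- x) :* d := x :* y :+ C :* d) refl C δ x y)
  (ℚ.+-mono-≤ (*-nonNegℚ hy 0≤x) (*-nonNegℚ x≤C 0≤δ))
... | inj₂ y≤0 | inj₂ x≤0 = subst (0ℚ ℚ.≤_)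
  (solve 4 (λ C d x y → (:- x) :* (:- y) :+ C :* d := x :* y :+ C :* d) refl C δ x y)
  (ℚ.+-mono-≤ (*-nonNegℚ (ℚ.neg-antimono-≤ x≤0) (ℚ.neg-antimono-≤ y≤0)) (*-nonNegℚ 0≤C 0≤δ))

/1-neg : ∀ i → (ℤ.- i) ℚ./ 1 ≡ ℚ.- (i ℚ./ 1)
/1-neg i = ℚ.toℚᵘ-injective (begin
  ℚ.toℚᵘ ((ℤ.- i) ℚ./ 1)      ≈⟨ ℚ.toℚᵘ-fromℚᵘ (mkℚᵘ (ℤ.- i) 0) ⟩
  mkℚᵘ (ℤ.- i) 0              ≈⟨ ℚᵘ.-‿cong (ℚ.toℚᵘ-fromℚᵘ (mkℚᵘ i 0)) ⟨
  ℚᵘ.- ℚ.toℚᵘ (i ℚ./ 1)       ≈⟨ ℚ.toℚᵘ-homo‿- (i ℚ./ 1) ⟨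
  ℚ.toℚᵘ (ℚ.- (i ℚ./ 1))      ∎)
  where open import Relation.Binary.Reasoning.Setoid ℚᵘ.≃-setoid

/1-+ : ∀ i j → (i ℤ.+ j) ℚ./ 1 ≡ i ℚ./ 1 ℚ.+ j ℚ./ 1
/1-+ i j = ℚ.toℚᵘ-injective (begin
  ℚ.toℚᵘ ((i ℤ.+ j) ℚ./ 1)                  ≈⟨ ℚ.toℚᵘ-fromℚᵘ (mkℚᵘ (i ℤ.+ j) 0) ⟩
  mkℚᵘ (i ℤ.+ j) 0
    ≈⟨ *≡* (cong (ℤ._* + 1) (cong₂ ℤ._+_ (sym (ℤ.*-identityʳ i)) (sym (ℤ.*-identityʳ j)))) ⟩
  mkℚᵘ i 0 ℚᵘ.+ mkℚᵘ j 0
    ≈⟨ ℚᵘ.+-cong (ℚ.toℚᵘ-fromℚᵘ (mkℚᵘ i 0)) (ℚ.toℚᵘ-fromℚᵘ (mkℚᵘ j 0)) ⟨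
  ℚ.toℚᵘ (i ℚ./ 1) ℚᵘ.+ ℚ.toℚᵘ (j ℚ./ 1)    ≈⟨ ℚ.toℚᵘ-homo-+ (i ℚ./ 1) (j ℚ./ 1) ⟨
  ℚ.toℚᵘ (i ℚ./ 1 ℚ.+ j ℚ./ 1)              ∎)
  where open import Relation.Binary.Reasoning.Setoid ℚᵘ.≃-setoid

/1-mono-≤ : ∀ {i j} → i ℤ.≤ j → i ℚ./ 1 ℚ.≤ j ℚ./ 1
/1-mono-≤ {i} {j} i≤j = ℚ.toℚᵘ-cancel-≤ (begin
  ℚ.toℚᵘ (i ℚ./ 1)  ≃⟨ ℚ.toℚᵘ-fromℚᵘ (mkℚᵘ i 0) ⟩
  mkℚᵘ i 0          ≤⟨ *≤* (ℤ.*-monoʳ-≤-nonNeg (+ 1) i≤j) ⟩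
  mkℚᵘ j 0          ≃⟨ ℚ.toℚᵘ-fromℚᵘ (mkℚᵘ j 0) ⟨
  ℚ.toℚᵘ (j ℚ./ 1)  ∎)
  where open ℚᵘ.≤-Reasoning

-- Real numbers.  NonNeg and Pos wrap 0 ≤ x and 0 < x in records because x
-- cannot be inferred from the unfolded relations.

infix 4 _≋_

-- Termwise equality instead of `_≈_`: a ring identity holds at every index, so one call of the
-- rational solver proves it.
_≋_ : ℝ → ℝ → Set
x ≋ y = ∀ n → seq x n ≡ seq y n

record NonNeg (x : ℝ) : Set where
  constructor nonNeg
  field 0≤ : 0ℝ ≤ x

record Pos (x : ℝ) : Set where
  constructor pos
  field 0< : 0ℝ < x

NonNeg-resp : ∀ {x y} → x ≋ y → NonNeg x → NonNeg y
NonNeg-resp x≋y (nonNeg h) = nonNeg λ ε 0<ε → let N , hN = h ε 0<ε in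
  N , λ n N≤n → subst (λ t → 0ℚ ℚ.≤ t ℚ.+ ε) (x≋y n) (hN n N≤n)

Pos-resp : ∀ {x y} → x ≋ y → Pos x → Pos y
Pos-resp x≋y (pos (ε , 0<ε , N , hN)) =
  pos (ε , 0<ε , N , λ n N≤n → subst (0ℚ ℚ.+ ε ℚ.≤_) (x≋y n) (hN n N≤n))

Pos⇒NonNeg : ∀ {x} → Pos x → NonNeg x
Pos⇒NonNeg {x} (pos (η , 0<η , N , hN)) = nonNeg λ ε 0<ε → N , λ n N≤n → begin
  0ℚ ℚ.+ 0ℚ      ≤⟨ ℚ.+-mono-≤ (ℚ.≤-trans (ℚ.<⇒≤ (subst (0ℚ ℚ.<_) (sym (ℚ.+-identityˡ η)) 0<η)) (hN n N≤n)) (ℚ.<⇒≤ 0<ε) ⟩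
  seq x n ℚ.+ ε  ∎
  where open ℚ.≤-Reasoning

1-pos : Pos 1ℝ
1-pos = pos (1ℚ , ℚ.positive⁻¹ 1ℚ , 0 , λ _ _ → ℚ.≤-refl)

infixl 6 _⊕_ _⊞_
infixl 7 _⊗_

_⊕_ : ∀ {x y} → NonNeg x → NonNeg y → NonNeg (x + y)
_⊕_ {x} {y} (nonNeg hx) (nonNeg hy) = nonNeg λ ε 0<ε →
  let M , hM = hx (½ ℚ.* ε) (half-pos 0<ε)
      N , hN = hy (½ ℚ.* ε) (half-pos 0<ε)
  in M ⊔ N , λ n h → subst (0ℚ ℚ.≤_)
    (solve 3 (λ x y e → (x :+ con ½ :* e) :+ (y :+ con ½ :* e) := (x :+ y) :+ e) refl
      (seq x n) (seq y n) ε)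
    (ℚ.+-mono-≤ (hM n (ℕ.m⊔n≤o⇒m≤o M N h)) (hN n (ℕ.m⊔n≤o⇒n≤o M N h)))

-- Half of the gap of `x` absorbs the error allowed to `y`. Most inequalities below are certificates
-- of this form: a positive term plus products of nonnegative ones, which the solver identifies with
-- the goal, or with 0 for a contradiction.
_⊞_ : ∀ {x y} → Pos x → NonNeg y → Pos (x + y)
_⊞_ {x} {y} (pos (ε , 0<ε , M , hM)) (nonNeg hy) =
  let N , hN = hy (½ ℚ.* ε) (half-pos 0<ε)
  in pos (½ ℚ.* ε , half-pos 0<ε , M ⊔ N , λ n h → begin
    0ℚ ℚ.+ ½ ℚ.* ε
      ≡⟨ solve 1 (λ e → con 0ℚ :+ con ½ :* e := (con 0ℚ :+ e) :+ (con 0ℚ :- con ½ :* e)) refl ε ⟩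
    (0ℚ ℚ.+ ε) ℚ.+ (0ℚ ℚ.- ½ ℚ.* ε)
      ≤⟨ ℚ.+-mono-≤ (hM n (ℕ.m⊔n≤o⇒m≤o M N h))
           (ℚ.+-monoˡ-≤ (ℚ.- (½ ℚ.* ε)) (hN n (ℕ.m⊔n≤o⇒n≤o M N h))) ⟩
    seq x n ℚ.+ ((seq y n ℚ.+ ½ ℚ.* ε) ℚ.- ½ ℚ.* ε)
      ≡⟨ solve 3 (λ x y e → x :+ ((y :+ e) :- e) := x :+ y) refl (seq x n) (seq y n) (½ ℚ.* ε) ⟩
    seq x n ℚ.+ seq y n ∎)
  where open ℚ.≤-Reasoning

bounded-above : ∀ x → Σ[ B ∈ ℚ ] 0ℚ ℚ.< B × Eventually λ n → seq x n ℚ.≤ B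
bounded-above x with cauchy x 1ℚ (ℚ.positive⁻¹ 1ℚ)
... | N , hN = 1ℚ ℚ.+ ∣ seq x N ∣ , ℚ.+-mono-<-≤ (ℚ.positive⁻¹ 1ℚ) (ℚ.0≤∣p∣ (seq x N)) , N , λ n N≤n → begin
  seq x n                                  ≡⟨ solve 2 (λ a b → a := (a :- b) :+ b) refl (seq x n) (seq x N) ⟩
  (seq x n ℚ.- seq x N) ℚ.+ seq x N        ≤⟨ ℚ.+-mono-≤ (ℚ.≤-trans (p≤∣p∣ _) (ℚ.<⇒≤ (hN n N N≤n ℕ.≤-refl))) (p≤∣p∣ (seq x N)) ⟩
  1ℚ ℚ.+ ∣ seq x N ∣                       ∎
  where open ℚ.≤-Reasoning

0≤q-p : ∀ {p q} → p ℚ.≤ q → 0ℚ ℚ.≤ q ℚ.- p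
0≤q-p {p} {q} p≤q = subst (ℚ._≤ q ℚ.- p) (ℚ.+-inverseʳ p) (ℚ.+-monoˡ-≤ (ℚ.- p) p≤q)

_⊗_ : ∀ {x y} → NonNeg x → NonNeg y → NonNeg (x * y)
_⊗_ {x} {y} (nonNeg hx) (nonNeg hy) = nonNeg λ ε 0<ε →
  let A , 0<A , K , x≤A = bounded-above x
      B , 0<B , L , y≤B = bounded-above y
      -- `C` eventually bounds both factors, and `δ` is chosen so that `C δ` is exactly `ε`.
      C     = A ℚ.+ B
      0<C   = ℚ.+-mono-< 0<A 0<B
      C≢0   = ℚ.pos⇒nonZero C {{ℚ.positive 0<C}}
      1/C   = ℚ.1/_ C {{C≢0}}
      δ     = 1/C ℚ.* ε
      0<δ   = ℚ.positive⁻¹ δ {{ℚ.pos*pos⇒pos 1/C {{ℚ.1/pos⇒pos C {{ℚ.positive 0<C}}}} ε {{ℚ.positive 0<ε}}}}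
      Cδ≡ε  = trans (sym (ℚ.*-assoc C 1/C ε)) (trans (cong (ℚ._* ε) (ℚ.*-inverseʳ C {{C≢0}})) (ℚ.*-identityˡ ε))
      M , hM = hx δ 0<δ
      N , hN = hy δ 0<δ
  in (K ⊔ L) ⊔ (M ⊔ N) , λ n h →
  let KL≤n = ℕ.m⊔n≤o⇒m≤o (K ⊔ L) (M ⊔ N) h
      MN≤n = ℕ.m⊔n≤o⇒n≤o (K ⊔ L) (M ⊔ N) h
      A≤C   = subst (ℚ._≤ C) (ℚ.+-identityʳ A) (ℚ.+-monoʳ-≤ A (ℚ.<⇒≤ 0<B))
      B≤C   = subst (ℚ._≤ C) (ℚ.+-identityˡ B) (ℚ.+-monoˡ-≤ B (ℚ.<⇒≤ 0<A))
  in subst (λ t → 0ℚ ℚ.≤ seq x n ℚ.* seq y n ℚ.+ t) Cδ≡ε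
    (product-lower-bound C δ (seq x n) (seq y n) (ℚ.<⇒≤ 0<δ)
      (hM n (ℕ.m⊔n≤o⇒m≤o M N MN≤n)) (hN n (ℕ.m⊔n≤o⇒n≤o M N MN≤n))
      (0≤q-p (ℚ.≤-trans (x≤A n (ℕ.m⊔n≤o⇒m≤o K L KL≤n)) A≤C))
      (0≤q-p (ℚ.≤-trans (y≤B n (ℕ.m⊔n≤o⇒n≤o K L KL≤n)) B≤C))
      (ℚ.<⇒≤ 0<C))

Pos-irrefl : ∀ {x} → x ≋ 0ℝ → ¬ Pos x
Pos-irrefl x≋0 (pos (ε , 0<ε , N , hN)) =
  ℚ.<-irrefl refl (ℚ.<-≤-trans 0<ε (subst₂ ℚ._≤_ (ℚ.+-identityˡ ε) (x≋0 N) (hN N ℕ.≤-refl)))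

-- Order on ℚ is decidable, so it suffices to refute a term below `- ε` past the Cauchy index for
-- `ε / 2`. Such a term keeps all later ones below `- ε / 2`, which makes `- x` positive.
¬Pos⇒NonNeg : ∀ {x} → ¬ Pos (- x) → NonNeg x
¬Pos⇒NonNeg {x} ¬-x>0 = nonNeg λ ε 0<ε →
  let N , hN = cauchy x (½ ℚ.* ε) (half-pos 0<ε)
  in N , λ n N≤n → ℚ.≮⇒≥ λ x+ε<0 → ¬-x>0 (pos (½ ℚ.* ε , half-pos 0<ε , N , λ m N≤m →
    ℚ.<⇒≤ (begin-strict
      0ℚ ℚ.+ ½ ℚ.* ε
        ≡⟨ solve 1 (λ e → con 0ℚ :+ con ½ :* e := :- (con ½ :* e) :+ e) refl ε ⟩
      ℚ.- (½ ℚ.* ε) ℚ.+ ε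
        <⟨ ℚ.+-monoˡ-< ε (∣p∣<q⇒-q<p (hN n m N≤n N≤m)) ⟩
      (seq x n ℚ.- seq x m) ℚ.+ ε
        ≡⟨ solve 3 (λ a b e → (a :- b) :+ e := (a :+ e) :- b) refl (seq x n) (seq x m) ε ⟩
      (seq x n ℚ.+ ε) ℚ.- seq x m
        <⟨ ℚ.+-monoˡ-< (ℚ.- seq x m) x+ε<0 ⟩
      0ℚ ℚ.- seq x m
        ≡⟨ ℚ.+-identityˡ (ℚ.- seq x m) ⟩
      ℚ.- seq x m ∎)))
  where open ℚ.≤-Reasoning

≤⇒NonNeg : ∀ x y → x ≤ y → NonNeg (y - x)
≤⇒NonNeg x y x≤y = nonNeg λ ε 0<ε → let N , hN = x≤y ε 0<ε in
  N , λ n N≤n → subst (0ℚ ℚ.≤_)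
    (solve 3 (λ x y e → (y :+ e) :- x := (y :- x) :+ e) refl (seq x n) (seq y n) ε)
    (0≤q-p (hN n N≤n))

NonNeg⇒≤ : ∀ x y → NonNeg (y - x) → x ≤ y
NonNeg⇒≤ x y (nonNeg h) ε 0<ε = let N , hN = h ε 0<ε in
  N , λ n N≤n → subst₂ ℚ._≤_ (ℚ.+-identityˡ (seq x n))
    (solve 3 (λ x y e → ((y :- x) :+ e) :+ x := y :+ e) refl (seq x n) (seq y n) ε)
    (ℚ.+-monoˡ-≤ (seq x n) (hN n N≤n))

<⇒Pos : ∀ x y → x < y → Pos (y - x)
<⇒Pos x y (ε , 0<ε , N , hN) = pos (ε , 0<ε , N , λ n N≤n → subst (ℚ._≤ seq y n ℚ.- seq x n)
  (solve 2 (λ x e → (x :+ e) :- x := con 0ℚ :+ e) refl (seq x n) ε)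
  (ℚ.+-monoˡ-≤ (ℚ.- seq x n) (hN n N≤n)))

Pos⇒< : ∀ x y → Pos (y - x) → x < y
Pos⇒< x y (pos (ε , 0<ε , N , hN)) = ε , 0<ε , N , λ n N≤n → subst₂ ℚ._≤_
  (solve 2 (λ x e → (con 0ℚ :+ e) :+ x := x :+ e) refl (seq x n) ε)
  (solve 2 (λ x y → (y :- x) :+ x := y) refl (seq x n) (seq y n))
  (ℚ.+-monoˡ-≤ (seq x n) (hN n N≤n))

≈⇒≥ : ∀ x y → x ≈ y → y ≤ x
≈⇒≥ x y x≈y ε 0<ε = let N , hN = x≈y ε 0<ε in
  N , λ n N≤n → subst₂ ℚ._≤_
    (solve 2 (λ x y → x :- (x :- y) := y) refl (seq x n) (seq y n))
    (solve 2 (λ x e → x :- :- e := x :+ e) refl (seq x n) ε)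
    (ℚ.+-monoʳ-≤ (seq x n) (ℚ.<⇒≤ (ℚ.neg-antimono-< (∣p∣<q⇒-q<p (hN n N≤n)))))

≤-antisym : ∀ x y → x ≤ y → y ≤ x → x ≈ y
≤-antisym x y x≤y y≤x ε 0<ε =
  let M , hM = x≤y (½ ℚ.* ε) (half-pos 0<ε)
      N , hN = y≤x (½ ℚ.* ε) (half-pos 0<ε)
  in M ⊔ N , λ n h → ℚ.≤-<-trans
    (abs≤ (seq x n) (seq y n) (hM n (ℕ.m⊔n≤o⇒m≤o M N h)) (hN n (ℕ.m⊔n≤o⇒n≤o M N h)))
    (subst₂ ℚ._<_ (ℚ.+-identityʳ (½ ℚ.* ε)) (half+half ε) (ℚ.+-monoʳ-< (½ ℚ.* ε) (half-pos 0<ε)))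
  where
  sub≤ : ∀ {δ} p q → p ℚ.≤ q ℚ.+ δ → p ℚ.- q ℚ.≤ δ
  sub≤ {δ} p q h = subst (p ℚ.- q ℚ.≤_)
    (solve 2 (λ q d → (q :+ d) :- q := d) refl q δ) (ℚ.+-monoˡ-≤ (ℚ.- q) h)
  abs≤ : ∀ {δ} p q → p ℚ.≤ q ℚ.+ δ → q ℚ.≤ p ℚ.+ δ → ∣ p ℚ.- q ∣ ℚ.≤ δ
  abs≤ {δ} p q p≤ q≤ with ℚ.≤-total 0ℚ (p ℚ.- q)
  ... | inj₁ h = subst (ℚ._≤ δ) (sym (ℚ.0≤p⇒∣p∣≡p h)) (sub≤ p q p≤)
  ... | inj₂ h = subst (ℚ._≤ δ)
    (trans (solve 2 (λ p q → q :- p := :- (p :- q)) refl p q)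
      (trans (sym (ℚ.0≤p⇒∣p∣≡p (ℚ.neg-antimono-≤ h))) (ℚ.∣-p∣≡∣p∣ (p ℚ.- q))))
    (sub≤ q p q≤)

-- Integers among the reals

fromℤ-mono : ∀ {i j} → i ℤ.≤ j → NonNeg (fromℤ j - fromℤ i)
fromℤ-mono {i} {j} i≤j = nonNeg λ ε 0<ε → 0 , λ n _ →
  ℚ.+-mono-≤ (0≤q-p (/1-mono-≤ i≤j)) (ℚ.<⇒≤ 0<ε)

fromℤ-cancel-< : ∀ {i j} → Pos (fromℤ j - fromℤ i) → i ℤ.< j
fromℤ-cancel-< {i} {j} h = ℤ.≰⇒> λ j≤i →
  Pos-irrefl (λ _ → solve 2 (λ i j → (j :- i) :+ (i :- j) := con 0ℚ) refl (i ℚ./ 1) (j ℚ./ 1))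
    (h ⊞ fromℤ-mono j≤i)

fromℤ-mono-< : ∀ {i j} → i ℤ.< j → NonNeg (fromℤ j - fromℤ i - 1ℝ)
fromℤ-mono-< {i} {j} i<j = NonNeg-resp
  (λ _ → trans (cong (λ t → j ℚ./ 1 ℚ.- t) (/1-+ (+ 1) i))
    (solve 2 (λ i j → j :- (con 1ℚ :+ i) := j :- i :- con 1ℚ) refl (i ℚ./ 1) (j ℚ./ 1)))
  (fromℤ-mono (ℤ.i<j⇒suc[i]≤j i<j))

-- Integrality: j < i would mean i - j ≥ 1. In this way strict real bounds with a slack of one unit,
-- such as those on the residual, become integer inequalities.
fromℤ-cancel-≤ : ∀ {i j} → Pos (1ℝ + (fromℤ j - fromℤ i)) → i ℤ.≤ j
fromℤ-cancel-≤ {i} {j} h = ℤ.≮⇒≥ λ j<i → Pos-irrefl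
  (λ _ → solve 2 (λ i j → con 1ℚ :+ (j :- i) :+ (i :- j :- con 1ℚ) := con 0ℚ) refl
    (i ℚ./ 1) (j ℚ./ 1))
  (h ⊞ fromℤ-mono-< j<i)

fromℤ-nonNeg : ∀ {i} → +0 ℤ.≤ i → NonNeg (fromℤ i)
fromℤ-nonNeg {i} 0≤i = NonNeg-resp (λ _ → ℚ.+-identityʳ (i ℚ./ 1)) (fromℤ-mono 0≤i)

fromℤ-nonPos : ∀ {i} → i ℤ.≤ +0 → NonNeg (- fromℤ i)
fromℤ-nonPos {i} i≤0 = NonNeg-resp (λ _ → ℚ.+-identityˡ (ℚ.- (i ℚ./ 1))) (fromℤ-mono i≤0)

fromℤ-pos : ∀ {i} → +0 ℤ.< i → NonNeg (fromℤ i - 1ℝ)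
fromℤ-pos {i} 0<i = NonNeg-resp
  (λ _ → solve 1 (λ i → i :- con 0ℚ :- con 1ℚ := i :- con 1ℚ) refl (i ℚ./ 1))
  (fromℤ-mono-< 0<i)

fromℤ-neg : ∀ {i} → i ℤ.< +0 → NonNeg (- fromℤ i - 1ℝ)
fromℤ-neg {i} i<0 = NonNeg-resp
  (λ _ → solve 1 (λ i → con 0ℚ :- i :- con 1ℚ := :- i :- con 1ℚ) refl (i ℚ./ 1))
  (fromℤ-mono-< i<0)

fromℤ-neg≤ : ∀ {i j} → ℤ.- j ℤ.≤ i → NonNeg (fromℤ i + fromℤ j)
fromℤ-neg≤ {i} {j} -j≤i = NonNeg-resp
  (λ _ → trans (cong (λ t → i ℚ./ 1 ℚ.- t) (/1-neg j))
    (solve 2 (λ i j → i :- :- j := i :+ j) refl (i ℚ./ 1) (j ℚ./ 1)))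
  (fromℤ-mono -j≤i)

fromℤ-<neg : ∀ {i j} → i ℤ.< ℤ.- j → NonNeg (- (fromℤ i + fromℤ j) - 1ℝ)
fromℤ-<neg {i} {j} i<-j = NonNeg-resp
  (λ _ → trans (cong (λ t → t ℚ.- i ℚ./ 1 ℚ.- 1ℚ) (/1-neg j))
    (solve 2 (λ i j → :- j :- i :- con 1ℚ := :- (i :+ j) :- con 1ℚ) refl (i ℚ./ 1) (j ℚ./ 1)))
  (fromℤ-mono-< i<-j)

Pos⇒0≤ : ∀ {i} → Pos (1ℝ + fromℤ i) → +0 ℤ.≤ i
Pos⇒0≤ {i} h = fromℤ-cancel-≤ (Pos-resp
  (λ _ → solve 1 (λ i → con 1ℚ :+ i := con 1ℚ :+ (i :- con 0ℚ)) refl (i ℚ./ 1)) h)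

Pos⇒≤0 : ∀ {i} → Pos (1ℝ - fromℤ i) → i ℤ.≤ +0
Pos⇒≤0 {i} h = fromℤ-cancel-≤ (Pos-resp
  (λ _ → solve 1 (λ i → con 1ℚ :- i := con 1ℚ :+ (con 0ℚ :- i)) refl (i ℚ./ 1)) h)

Pos⇒≤neg : ∀ {i j} → Pos (1ℝ - (fromℤ i + fromℤ j)) → i ℤ.≤ ℤ.- j
Pos⇒≤neg {i} {j} h = fromℤ-cancel-≤ (Pos-resp
  (λ _ → sym (trans (cong (λ t → 1ℚ ℚ.+ (t ℚ.- i ℚ./ 1)) (/1-neg j))
    (solve 2 (λ i j → con 1ℚ :+ (:- j :- i) := con 1ℚ :- (i :+ j)) refl (i ℚ./ 1) (j ℚ./ 1)))) h)

Pos⇒neg< : ∀ {i j} → Pos (fromℤ i + fromℤ j) → ℤ.- j ℤ.< i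
Pos⇒neg< {i} {j} h = fromℤ-cancel-< (Pos-resp
  (λ _ → sym (trans (cong (λ t → i ℚ./ 1 ℚ.- t) (/1-neg j))
    (solve 2 (λ i j → i :- :- j := i :+ j) refl (i ℚ./ 1) (j ℚ./ 1)))) h)

dichotomy : ∀ x → ¬ ¬ (NonNeg x ⊎ NonNeg (- x))
dichotomy x k = k (inj₁ (¬Pos⇒NonNeg λ -x>0 → k (inj₂ (Pos⇒NonNeg -x>0))))

-- Periodic sequences

shift-comm : ∀ m n o → m ℕ.+ n ℕ.+ o ≡ m ℕ.+ o ℕ.+ n
shift-comm m n o = begin
  m ℕ.+ n ℕ.+ o    ≡⟨ ℕ.+-assoc m n o ⟩
  m ℕ.+ (n ℕ.+ o)  ≡⟨ cong (m ℕ.+_) (ℕ.+-comm n o) ⟩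
  m ℕ.+ (o ℕ.+ n)  ≡⟨ ℕ.+-assoc m o n ⟨
  m ℕ.+ o ℕ.+ n    ∎
  where open ≡-Reasoning

-- Writing the period as `suc q` keeps it positive and lets `_%_` apply directly.
Periodic : {A : Set} → (ℕ → A) → Set
Periodic f = ∃[ q ] (∀ n → f (n ℕ.+ suc q) ≡ f n)

module _ {A : Set} {f : ℕ → A} (f-per : Periodic f) where

  private
    q = proj₁ f-per

  periodic-* : ∀ m n → f (n ℕ.+ m ℕ.* suc q) ≡ f n
  periodic-* zero    n = cong f (ℕ.+-identityʳ n)
  periodic-* (suc m) n = begin
    f (n ℕ.+ (suc q ℕ.+ m ℕ.* suc q))  ≡⟨ cong f (ℕ.+-assoc n (suc q) (m ℕ.* suc q)) ⟨
    f (n ℕ.+ suc q ℕ.+ m ℕ.* suc q)    ≡⟨ periodic-* m (n ℕ.+ suc q) ⟩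
    f (n ℕ.+ suc q)                    ≡⟨ proj₂ f-per n ⟩
    f n                                ∎
    where open ≡-Reasoning

  periodic-% : ∀ n → f n ≡ f (n ℕ.% suc q)
  periodic-% n = trans (cong f (ℕ.m≡m%n+[m/n]*n n (suc q))) (periodic-* (n ℕ./ suc q) (n ℕ.% suc q))

  -- Adding `k` full periods to `n` does not change the value and leads to an index of at least `k`.
  periodic-from : ∀ {P : A → Set} k → (∀ m → P (f (m ℕ.+ k))) → ∀ n → P (f n)
  periodic-from {P} k h n = subst P (trans (cong f (begin
    n ℕ.+ k ℕ.* q ℕ.+ k    ≡⟨ ℕ.+-assoc n (k ℕ.* q) k ⟩
    n ℕ.+ (k ℕ.* q ℕ.+ k)  ≡⟨ cong (n ℕ.+_) (ℕ.+-comm (k ℕ.* q) k) ⟩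
    n ℕ.+ (k ℕ.+ k ℕ.* q)  ≡⟨ cong (n ℕ.+_) (ℕ.*-suc k q) ⟨
    n ℕ.+ k ℕ.* suc q      ∎)) (periodic-* k n)) (h (n ℕ.+ k ℕ.* q))
    where open ≡-Reasoning

  periodic-∘ : {B : Set} (g : A → B) → Periodic (λ n → g (f n))
  periodic-∘ g = q , λ n → cong g (proj₂ f-per n)

  periodic-shift : ∀ k → Periodic (λ n → f (n ℕ.+ k))
  periodic-shift k = q , λ n → trans (cong f (shift-comm n (suc q) k)) (proj₂ f-per (n ℕ.+ k))

  module _ (_≲_ : A → A → Set) (≲-trans : ∀ {x y z} → x ≲ y → y ≲ z → x ≲ z)
           (≲-total : ∀ x y → ¬ ¬ (x ≲ y ⊎ y ≲ x)) where

    bounded-argmax : ∀ N → ¬ ¬ (∃[ k ] (∀ n → n ℕ.≤ N → f n ≲ f k))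
    -- Reflexivity of the order is read off from totality at equal arguments.
    bounded-argmax zero    c = ≲-total (f 0) (f 0) λ
      s → c (0 , λ { zero _ → [ (λ h → h) , (λ h → h) ]′ s })
    bounded-argmax (suc N) c = bounded-argmax N λ (k , max) → ≲-total (f (suc N)) (f k) λ where
      (inj₁ N≲k) → c (k , λ n n≤ → [ (λ n<sN → max n (ℕ.s≤s⁻¹ n<sN)) , (λ { refl → N≲k }) ]′ (ℕ.m≤n⇒m<n∨m≡n n≤))
      (inj₂ k≲N) → ≲-total (f (suc N)) (f (suc N)) λ s → c (suc N , λ n n≤ →
        [ (λ n<sN → ≲-trans (max n (ℕ.s≤s⁻¹ n<sN)) k≲N)
        , (λ { refl → [ (λ h → h) , (λ h → h) ]′ s }) ]′ (ℕ.m≤n⇒m<n∨m≡n n≤))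

    -- A maximum over one period is global. It is moved one period on, so that its index is a
    -- successor and the entry before it is available to the recurrence.
    argmax : ¬ ¬ (∃[ k ] (∀ n → f n ≲ f (suc k)))
    argmax c = bounded-argmax q λ (k , max) → c (k ℕ.+ q , λ n →
      subst₂ _≲_ (sym (periodic-% n))
        (sym (trans (cong f (sym (ℕ.+-suc k q))) (proj₂ f-per k)))
        (max (n ℕ.% suc q) (ℕ.s≤s⁻¹ (ℕ.m%n<n n (suc q)))))

ℤ-argmax : ∀ {f : ℕ → ℤ} → Periodic f → ¬ ¬ (∃[ k ] (∀ n → f n ℤ.≤ f (suc k)))
ℤ-argmax f-per = argmax f-per ℤ._≤_ ℤ.≤-trans λ x y c → c (ℤ.≤-total x y)

ℤ-argmin : ∀ {f : ℕ → ℤ} → Periodic f → ¬ ¬ (∃[ k ] (∀ n → f (suc k) ℤ.≤ f n))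
ℤ-argmin f-per = argmax f-per (flip ℤ._≤_) (flip ℤ.≤-trans) λ x y c → c (ℤ.≤-total y x)

-- A positive entry would make the maximum positive, against `h`. Since the bound is proved by
-- refuting such an entry, a doubly negated maximum is enough.
max-principle : ∀ {f : ℕ → ℤ} → Periodic f →
  (∀ k → (∀ n → f n ℤ.≤ f (suc k)) → +0 ℤ.≤ f (suc k) → f (suc k) ℤ.≤ +0) →
  ∀ n → f n ℤ.≤ +0
max-principle f-per h n = ℤ.≮⇒≥ λ 0<fn → ℤ-argmax f-per λ (k , max) →
  let 0<max = ℤ.<-≤-trans 0<fn (max n) in
  ℤ.<⇒≱ 0<max (h k max (ℤ.<⇒≤ 0<max))

min-principle : ∀ {f : ℕ → ℤ} → Periodic f →
  (∀ k → (∀ n → f (suc k) ℤ.≤ f n) → f (suc k) ℤ.≤ +0 → +0 ℤ.≤ f (suc k)) →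
  ∀ n → +0 ℤ.≤ f n
min-principle f-per h n = ℤ.≮⇒≥ λ fn<0 → ℤ-argmin f-per λ (k , min) →
  let min<0 = ℤ.≤-<-trans (min n) fn<0 in
  ℤ.<⇒≱ min<0 (h k min (ℤ.<⇒≤ min<0))

-- The recurrence

∣∣≤-nonNeg : ∀ i j → +0 ℤ.≤ j → ℤ.∣ i ∣ ℕ.≤ ℤ.∣ j ∣ → i ℤ.≤ j × ℤ.- j ℤ.≤ i
∣∣≤-nonNeg (+ m)        (+ n)     _ m≤n = ℤ.+≤+ m≤n , ℤ.neg-≤-pos
∣∣≤-nonNeg ℤ.-[1+ m ] (+ suc n) _ m≤n = ℤ.-≤+ , ℤ.-≤- (ℕ.s≤s⁻¹ m≤n)

∣∣≤-nonPos : ∀ i j → j ℤ.≤ +0 → ℤ.∣ i ∣ ℕ.≤ ℤ.∣ j ∣ → j ℤ.≤ i × i ℤ.≤ ℤ.- j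
∣∣≤-nonPos i j j≤0 i≤j =
  let i≤-j , j≤i = ∣∣≤-nonNeg i (ℤ.- j) (ℤ.neg-mono-≤ j≤0) (subst (ℤ.∣ i ∣ ℕ.≤_) (sym (ℤ.∣-i∣≡∣i∣ j)) i≤j) in
  subst (ℤ._≤ i) (ℤ.neg-involutive j) j≤i , i≤-j


module Recurrence (r₀ r₁ : ℝ) where

  residual : (ℕ → ℤ) → ℕ → ℝ
  residual f n = r₀ * fromℤ (f n) + r₁ * fromℤ (f (suc n)) + fromℤ (f (suc (suc n)))

  -- Unlike 0 ≤ residual < 1, this is invariant under f ↦ - f.
  record SmallResidual (f : ℕ → ℤ) : Set where
    field
      residual>-1 : ∀ n → Pos (1ℝ + residual f n)
      residual<1  : ∀ n → Pos (1ℝ - residual f n)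

  record FloorOrbit (f : ℕ → ℤ) : Set where
    field
      residual≥0    : ∀ n → NonNeg (residual f n)
      smallResidual : SmallResidual f

  open SmallResidual
  open FloorOrbit

  small-neg : ∀ {f} → SmallResidual f → SmallResidual (λ n → ℤ.- f n)
  small-neg {f} small = record
    { residual>-1 = λ n → Pos-resp (λ m → cong (1ℚ ℚ.+_) (residual-neg n m)) (residual<1 small n)
    ; residual<1  = λ n → Pos-resp
      (λ m → trans
        (solve 1 (λ e → con 1ℚ :+ e := con 1ℚ :- (:- e)) refl (seq (residual f n) m))
        (cong (λ t → 1ℚ ℚ.- t) (residual-neg n m)))
      (residual>-1 small n)
    }
    where
    residual-neg : ∀ n → - residual f n ≋ residual (λ n → ℤ.- f n) n
    residual-neg n m = trans
      (solve 5 (λ r s x y z → :- (r :* x :+ s :* y :+ z) := r :* (:- x) :+ s :* (:- y) :+ (:- z)) refl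
        (seq r₀ m) (seq r₁ m) (f n ℚ./ 1) (f (suc n) ℚ./ 1) (f (suc (suc n)) ℚ./ 1))
      (cong₂ ℚ._+_ (cong₂ ℚ._+_ (cong (seq r₀ m ℚ.*_) (sym (/1-neg (f n))))
                                (cong (seq r₁ m ℚ.*_) (sym (/1-neg (f (suc n))))))
                   (sym (/1-neg (f (suc (suc n))))))

  small-shift : ∀ {f} → SmallResidual f → ∀ k → SmallResidual (λ n → f (n ℕ.+ k))
  small-shift small k = record
    { residual>-1 = λ n → residual>-1 small (n ℕ.+ k)
    ; residual<1  = λ n → residual<1 small (n ℕ.+ k)
    }

  -- Region (ii) with a nonnegative coefficient

  module _ (0≤r₀ : NonNeg r₀) (r₀+r₁≤-2 : NonNeg (- 2ℝ - (r₀ + r₁))) where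
    -- With the maximum `y` in the middle position, raising both neighbours to `y` does not lower
    -- the residual, so -1 < (r₀ + r₁ + 1) y ≤ - y.
    nonPos-r₁ : ∀ {f} → Periodic f → SmallResidual f → ∀ n → f n ℤ.≤ +0
    nonPos-r₁ {f} f-per small = max-principle f-per λ k max 0≤max → Pos⇒≤0 (Pos-resp
      (λ m → solve 5 (λ r s x y z →
          con 1ℚ :+ (r :* x :+ s :* y :+ z) :+ (y :- z) :+ r :* (y :- x) :+ (:- con 2ℚ :- (r :+ s)) :* y
            := con 1ℚ :- y) refl
        (seq r₀ m) (seq r₁ m) (f k ℚ./ 1) (f (suc k) ℚ./ 1) (f (suc (suc k)) ℚ./ 1))
      (residual>-1 small k ⊞ fromℤ-mono (max (suc (suc k))) ⊞ 0≤r₀ ⊗ fromℤ-mono (max k)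
        ⊞ r₀+r₁≤-2 ⊗ fromℤ-nonNeg 0≤max))

  module _ (0≤r₁ : NonNeg r₁) (r₀+r₁≤-2 : NonNeg (- 2ℝ - (r₀ + r₁))) where
    -- Now the last two coefficients are nonnegative, so the maximum is put in the first position
    -- and the other two entries are raised to it.
    nonPos-r₀ : ∀ {f} → Periodic f → SmallResidual f → ∀ n → f n ℤ.≤ +0
    nonPos-r₀ {f} f-per small = max-principle f-per λ k max 0≤max → Pos⇒≤0 (Pos-resp
      (λ m → solve 5 (λ r s x y z →
          con 1ℚ :+ (r :* x :+ s :* y :+ z) :+ (x :- z) :+ s :* (x :- y) :+ (:- con 2ℚ :- (r :+ s)) :* x
            := con 1ℚ :- x) refl
        (seq r₀ m) (seq r₁ m) (f (suc k) ℚ./ 1) (f (suc (suc k)) ℚ./ 1) (f (suc (suc (suc k))) ℚ./ 1))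
      (residual>-1 small (suc k) ⊞ fromℤ-mono (max (suc (suc (suc k))))
        ⊞ 0≤r₁ ⊗ fromℤ-mono (max (suc (suc k))) ⊞ r₀+r₁≤-2 ⊗ fromℤ-nonNeg 0≤max))

  nonPos⇒zero : (∀ {f} → Periodic f → SmallResidual f → ∀ n → f n ℤ.≤ +0) →
    ∀ {f} → Periodic f → FloorOrbit f → ∀ n → f n ≡ +0
  nonPos⇒zero nonPos {f} f-per orb n = ℤ.≤-antisym
    (nonPos f-per (smallResidual orb) n)
    (ℤ.neg-cancel-≤ (nonPos (periodic-∘ f-per (λ i → ℤ.- i)) (small-neg (smallResidual orb)) n))

  -- Region (i)

  -- With μ = - r₁ - s and c = s μ - r₀ ≥ 0, the recurrence becomes the cooperative system
  --   s f n = f (n + 1) + β n,  μ β n = β (n + 1) + c f n + residual f n;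
  -- evaluating its two equations at the maxima of f and of β bounds max f.
  module _ (s : ℝ) (0≤s : NonNeg s) (r₀≤s² : NonNeg (s * s - r₀))
           (0<r₀ : Pos r₀) (r₁≤-2s : NonNeg (- (2ℝ * s) - r₁)) (0≤r₀+r₁ : NonNeg (r₀ + r₁)) where

    -- If s < 1, then r₀ ≤ s² ≤ s, while r₀ ≥ - r₁ ≥ 2 s ≥ 2 r₀ contradicts r₀ > 0.
    1≤s : NonNeg (s - 1ℝ)
    1≤s = ¬Pos⇒NonNeg λ s<1 →
      let s²≤s = 0≤s ⊗ Pos⇒NonNeg s<1 ⊕ r₀≤s² in
      Pos-irrefl
        (λ m → solve 3 (λ r t s →
            r :+ (s :* (:- (s :- con 1ℚ)) :+ (s :* s :- r)) :+ (s :* (:- (s :- con 1ℚ)) :+ (s :* s :- r))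
              :+ (r :+ t) :+ (:- (con 2ℚ :* s) :- t)
              := con 0ℚ) refl
          (seq r₀ m) (seq r₁ m) (seq s m))
        (0<r₀ ⊞ s²≤s ⊞ s²≤s ⊞ 0≤r₀+r₁ ⊞ r₁≤-2s)

    module _ (f : ℕ → ℤ) where
      β : ℕ → ℝ
      β n = s * fromℤ (f n) - fromℤ (f (suc n))

      β-argmax : Periodic f → ¬ ¬ (∃[ k ] (∀ n → NonNeg (β (suc k) - β n)))
      β-argmax (q , f-per) = argmax
        (q , λ n → cong₂ (λ i j → s * fromℤ i - fromℤ j) (f-per n) (f-per (suc n)))
        (λ x y → NonNeg (y - x))
        (λ {x} {y} {z} y-x z-y → NonNeg-resp
          (λ m → solve 3 (λ x y z → (y :- x) :+ (z :- y) := z :- x) refl (seq x m) (seq y m) (seq z m))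
          (y-x ⊕ z-y))
        (λ x y c → dichotomy (y - x) λ where
          (inj₁ h) → c (inj₁ h)
          (inj₂ h) → c (inj₂ (NonNeg-resp
            (λ m → solve 2 (λ x y → :- (y :- x) := x :- y) refl (seq x m) (seq y m)) h)))

    -- Let `x` and B be the maxima of `f` and `β`. The first equation at `x` gives (s - 1) x ≤ B,
    -- and the second at B gives (μ - 1) B < 1 + c x. As μ ≥ 1 by `1≤s`, eliminating B leaves (1 +
    -- r₀ + r₁) x < 1, hence x < 1. The two long factors in the certificate are c and μ - 1.
    nonPos-real-roots : ∀ {f} → Periodic f → SmallResidual f → ∀ n → f n ℤ.≤ +0
    nonPos-real-roots {f} f-per small = max-principle f-per λ k max 0≤max →
      ℤ.≮⇒≥ λ 0<max → β-argmax f f-per λ (j , βmax) → ℤ.<⇒≱ 0<max (Pos⇒≤0 (Pos-resp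
        (λ m → solve 8 (λ r t s x x′ u v w →
            con 1ℚ :- (r :* u :+ t :* v :+ w)
              :+ ((s :* u :- v) :- (s :* v :- w))
              :+ (s :* (:- (con 2ℚ :* s) :- t) :+ (s :* s :- r)) :* (x :- u)
              :+ ((:- (con 2ℚ :* s) :- t) :+ (s :- con 1ℚ))
                   :* (((s :* u :- v) :- (s :* x :- x′)) :+ (x :- x′))
              :+ (r :+ t) :* x
              := con 1ℚ :- x) refl
          (seq r₀ m) (seq r₁ m) (seq s m) (f (suc k) ℚ./ 1) (f (suc (suc k)) ℚ./ 1)
          (f (suc j) ℚ./ 1) (f (suc (suc j)) ℚ./ 1) (f (suc (suc (suc j))) ℚ./ 1))
        (residual<1 small (suc j)
          ⊞ βmax (suc (suc j))
          ⊞ (0≤s ⊗ r₁≤-2s ⊕ r₀≤s²) ⊗ fromℤ-mono (max (suc j))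
          ⊞ (r₁≤-2s ⊕ 1≤s) ⊗ (βmax (suc k) ⊕ fromℤ-mono (max (suc (suc k))))
          ⊞ 0≤r₀+r₁ ⊗ fromℤ-nonNeg 0≤max)))

  -- Region (ii) with both coefficients nonpositive

  module _ (r₀≤0 : NonNeg (- r₀)) (r₁≤0 : NonNeg (- r₁)) (r₀+r₁≤-2 : NonNeg (- 2ℝ - (r₀ + r₁)))
           (large : NonNeg (- 1ℝ - r₁) ⊎ (NonNeg (- 2ℝ - r₀) × NonNeg (1ℝ + r₁))) where

    -- If r₁ ≤ -1, the entry after a maximum `y` is at least `y`, and the recurrence starting at `y`
    -- gives -1 < (r₀ + r₁ + 1) y ≤ - y. If r₀ ≤ -2, the maximum `x` in the first position already
    -- gives -1 < (r₀ + 1) x ≤ - x.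
    nonNeg⇒nonPos : ∀ {f} → Periodic f → SmallResidual f → (∀ n → +0 ℤ.≤ f n) → ∀ n → f n ℤ.≤ +0
    nonNeg⇒nonPos {f} f-per small 0≤f = max-principle f-per λ k max 0≤max →
      [ (λ r₁≤-1 →
          let y≤z : f (suc k) ℤ.≤ f (suc (suc k))
              y≤z = fromℤ-cancel-≤ (Pos-resp
                (λ m → solve 5 (λ r s x y z →
                    con 1ℚ :+ (r :* x :+ s :* y :+ z) :+ (:- con 1ℚ :- s) :* y :+ (:- r) :* x
                      := con 1ℚ :+ (z :- y)) refl
                  (seq r₀ m) (seq r₁ m) (f k ℚ./ 1) (f (suc k) ℚ./ 1) (f (suc (suc k)) ℚ./ 1))
                (residual>-1 small k ⊞ r₁≤-1 ⊗ fromℤ-nonNeg 0≤max ⊞ r₀≤0 ⊗ fromℤ-nonNeg (0≤f k)))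
          in Pos⇒≤0 (Pos-resp
            (λ m → solve 5 (λ r s y z w →
                con 1ℚ :+ (r :* y :+ s :* z :+ w) :+ (y :- w) :+ (:- s) :* (z :- y)
                  :+ (:- con 2ℚ :- (r :+ s)) :* y
                  := con 1ℚ :- y) refl
              (seq r₀ m) (seq r₁ m) (f (suc k) ℚ./ 1) (f (suc (suc k)) ℚ./ 1) (f (suc (suc (suc k))) ℚ./ 1))
            (residual>-1 small (suc k) ⊞ fromℤ-mono (max (suc (suc (suc k))))
              ⊞ r₁≤0 ⊗ fromℤ-mono y≤z ⊞ r₀+r₁≤-2 ⊗ fromℤ-nonNeg 0≤max)))
      , (λ (r₀≤-2 , _) → Pos⇒≤0 (Pos-resp
          (λ m → solve 5 (λ r s x y z →
              con 1ℚ :+ (r :* x :+ s :* y :+ z) :+ (x :- z) :+ (:- s) :* y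
                :+ (:- con 2ℚ :- r) :* x
                := con 1ℚ :- x) refl
            (seq r₀ m) (seq r₁ m) (f (suc k) ℚ./ 1) (f (suc (suc k)) ℚ./ 1) (f (suc (suc (suc k))) ℚ./ 1))
          (residual>-1 small (suc k) ⊞ fromℤ-mono (max (suc (suc (suc k))))
            ⊞ r₁≤0 ⊗ fromℤ-nonNeg (0≤f (suc (suc k))) ⊞ r₀≤-2 ⊗ fromℤ-nonNeg 0≤max)))
      ]′ large

    nonNeg-forward : ∀ {f} → SmallResidual f → +0 ℤ.≤ f 0 → +0 ℤ.≤ f 1 →
      ∀ n → +0 ℤ.≤ f n × +0 ℤ.≤ f (suc n)
    nonNeg-forward small 0≤f₀ 0≤f₁ zero = 0≤f₀ , 0≤f₁
    nonNeg-forward {f} small 0≤f₀ 0≤f₁ (suc n) =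
      let 0≤x , 0≤y = nonNeg-forward small 0≤f₀ 0≤f₁ n in
      0≤y , Pos⇒0≤ (Pos-resp
        (λ m → solve 5 (λ r s x y z →
            con 1ℚ :+ (r :* x :+ s :* y :+ z) :+ (:- r) :* x :+ (:- s) :* y := con 1ℚ :+ z) refl
          (seq r₀ m) (seq r₁ m) (f n ℚ./ 1) (f (suc n) ℚ./ 1) (f (suc (suc n)) ℚ./ 1))
        (residual>-1 small n ⊞ r₀≤0 ⊗ fromℤ-nonNeg 0≤x ⊞ r₁≤0 ⊗ fromℤ-nonNeg 0≤y))

    -- Nonnegativity propagates forward from the pair, so the tail vanishes, and periodicity carries
    -- this back to all indices.
    nonNeg-pair⇒zero : ∀ {f} → Periodic f → SmallResidual f →
      ∀ k → +0 ℤ.≤ f k → +0 ℤ.≤ f (suc k) → ∀ n → f n ≡ +0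
    nonNeg-pair⇒zero {f} f-per small k 0≤x 0≤y =
      periodic-from f-per {_≡ +0} k λ m → ℤ.≤-antisym
        (nonNeg⇒nonPos (periodic-shift f-per k) (small-shift small k) 0≤f m) (0≤f m)
      where
      0≤f : ∀ m → +0 ℤ.≤ f (m ℕ.+ k)
      0≤f m = proj₁ (nonNeg-forward (small-shift small k) 0≤x 0≤y m)

    nonPos-pair⇒zero : ∀ {f} → Periodic f → SmallResidual f →
      ∀ k → f k ℤ.≤ +0 → f (suc k) ℤ.≤ +0 → ∀ n → f n ≡ +0
    nonPos-pair⇒zero f-per small k x≤0 y≤0 n = ℤ.neg-injective
      (nonNeg-pair⇒zero (periodic-∘ f-per (λ i → ℤ.- i)) (small-neg small) k
        (ℤ.neg-mono-≤ x≤0) (ℤ.neg-mono-≤ y≤0) n)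

    module _ {f : ℕ → ℤ} (f-per : Periodic f) (orb : FloorOrbit f)
             (pos-neg : ∀ k → +0 ℤ.< f k → f (suc k) ℤ.< +0)
             (neg-pos : ∀ k → f k ℤ.< +0 → +0 ℤ.< f (suc k)) where

      ∣f∣-max : ℕ → Set
      ∣f∣-max k = ∀ n → ℤ.∣ f n ∣ ℕ.≤ ℤ.∣ f k ∣

      ∣f∣-min : ℕ → Set
      ∣f∣-min k = ∀ n → ℤ.∣ f k ∣ ℕ.≤ ℤ.∣ f n ∣

      module _ (d : Pos (- (r₀ - r₁ + 1ℝ))) where
        -- From z ≤ x and y ≥ - x the residual is at most (r₀ - r₁ + 1) x < 0.
        max-not-pos : ∀ k → ∣f∣-max k → ¬ (+0 ℤ.< f k)
        max-not-pos k max 0<x = Pos-irrefl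
          (λ m → solve 5 (λ r s x y z →
              :- (r :- s :+ con 1ℚ) :+ (:- (r :- s :+ con 1ℚ)) :* (x :- con 1ℚ)
                :+ (r :* x :+ s :* y :+ z) :+ (x :- z) :+ (:- s) :* (y :+ x)
                := con 0ℚ) refl
            (seq r₀ m) (seq r₁ m) (f k ℚ./ 1) (f (suc k) ℚ./ 1) (f (suc (suc k)) ℚ./ 1))
          (d ⊞ Pos⇒NonNeg d ⊗ fromℤ-pos 0<x ⊞ residual≥0 orb k
            ⊞ fromℤ-mono (proj₁ (∣∣≤-nonNeg (f (suc (suc k))) (f k) (ℤ.<⇒≤ 0<x) (max (suc (suc k)))))
            ⊞ r₁≤0 ⊗ fromℤ-neg≤ {f (suc k)} (proj₂ (∣∣≤-nonNeg (f (suc k)) (f k) (ℤ.<⇒≤ 0<x) (max (suc k)))))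

        -- If y = - x, the successor is a positive entry of maximal modulus. Otherwise y ≤ - x - 1,
        -- and this unit raises the lower bound for the residual to (r₀ - r₁ + 1) x - r₁, which is
        -- at least 1 in both cases of `large`.
        max-not-neg : ∀ k → ∣f∣-max k → ¬ (f k ℤ.< +0)
        max-not-neg k max x<0 with f (suc k) ℤ.≟ ℤ.- f k
        ... | yes y≡-x = max-not-pos (suc k)
          (λ n → subst (ℤ.∣ f n ∣ ℕ.≤_) (sym (trans (cong ℤ.∣_∣ y≡-x) (ℤ.∣-i∣≡∣i∣ (f k)))) (max n))
          (neg-pos k x<0)
        ... | no y≢-x = [ contra₁ , contra₂ ]′ large
          where
          y<-x : f (suc k) ℤ.< ℤ.- f k
          y<-x = ℤ.≤∧≢⇒< (proj₂ (∣∣≤-nonPos (f (suc k)) (f k) (ℤ.<⇒≤ x<0) (max (suc k)))) y≢-x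
          x≤z : f k ℤ.≤ f (suc (suc k))
          x≤z = proj₁ (∣∣≤-nonPos (f (suc (suc k))) (f k) (ℤ.<⇒≤ x<0) (max (suc (suc k))))
          contra₁ : ¬ NonNeg (- 1ℝ - r₁)
          contra₁ r₁≤-1 = Pos-irrefl
            (λ m → solve 5 (λ r s x y z →
                con 1ℚ :- (r :* x :+ s :* y :+ z) :+ (z :- x) :+ (:- s) :* (:- (y :+ x) :- con 1ℚ)
                  :+ (:- (r :- s :+ con 1ℚ)) :* (:- x) :+ (:- con 1ℚ :- s)
                  := con 0ℚ) refl
              (seq r₀ m) (seq r₁ m) (f k ℚ./ 1) (f (suc k) ℚ./ 1) (f (suc (suc k)) ℚ./ 1))
            (residual<1 (smallResidual orb) k ⊞ fromℤ-mono x≤z ⊞ r₁≤0 ⊗ fromℤ-<neg y<-x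
              ⊞ Pos⇒NonNeg d ⊗ fromℤ-nonPos (ℤ.<⇒≤ x<0) ⊞ r₁≤-1)
          contra₂ : ¬ (NonNeg (- 2ℝ - r₀) × NonNeg (1ℝ + r₁))
          contra₂ (r₀≤-2 , -1≤r₁) = Pos-irrefl
            (λ m → solve 5 (λ r s x y z →
                con 1ℚ :- (r :* x :+ s :* y :+ z) :+ (z :- x) :+ (:- s) :* (:- (y :+ x) :- con 1ℚ)
                  :+ (:- con 2ℚ :- r) :* (:- x) :+ (con 1ℚ :+ s) :* (:- x :- con 1ℚ)
                  := con 0ℚ) refl
              (seq r₀ m) (seq r₁ m) (f k ℚ./ 1) (f (suc k) ℚ./ 1) (f (suc (suc k)) ℚ./ 1))
            (residual<1 (smallResidual orb) k ⊞ fromℤ-mono x≤z ⊞ r₁≤0 ⊗ fromℤ-<neg y<-x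
              ⊞ r₀≤-2 ⊗ fromℤ-nonPos (ℤ.<⇒≤ x<0) ⊞ -1≤r₁ ⊗ fromℤ-neg x<0)

      module _ (d : Pos (r₀ - r₁ + 1ℝ)) where
        -- Alternation and minimality give y ≥ - x and z ≤ x, so the residual is at most (r₀ - r₁ +
        -- 1) x < 0.
        min-not-neg : ∀ k → ∣f∣-min k → ¬ (f k ℤ.< +0)
        min-not-neg k min x<0 = Pos-irrefl
          (λ m → solve 5 (λ r s x y z →
              (r :- s :+ con 1ℚ) :+ (r :- s :+ con 1ℚ) :* (:- x :- con 1ℚ)
                :+ (r :* x :+ s :* y :+ z) :+ (x :- z) :+ (:- s) :* (x :+ y)
                := con 0ℚ) refl
            (seq r₀ m) (seq r₁ m) (f k ℚ./ 1) (f (suc k) ℚ./ 1) (f (suc (suc k)) ℚ./ 1))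
          (d ⊞ Pos⇒NonNeg d ⊗ fromℤ-neg x<0 ⊞ residual≥0 orb k
            ⊞ fromℤ-mono (proj₁ (∣∣≤-nonPos (f k) (f (suc (suc k))) (ℤ.<⇒≤ (pos-neg (suc k) 0<y)) (min (suc (suc k)))))
            ⊞ r₁≤0 ⊗ fromℤ-neg≤ {f k} (proj₂ (∣∣≤-nonNeg (f k) (f (suc k)) (ℤ.<⇒≤ 0<y) (min (suc k)))))
          where
          0<y : +0 ℤ.< f (suc k)
          0<y = neg-pos k x<0

        -- As at a negative maximum: either the successor is a negative entry of minimal modulus, or
        -- y ≤ - x - 1 and the residual is at least (r₀ - r₁ + 1) x - r₁ ≥ 1.
        min-not-pos : ∀ k → ∣f∣-min k → ¬ (+0 ℤ.< f k)
        min-not-pos k min 0<x with f k ℤ.≟ ℤ.- f (suc k)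
        ... | yes x≡-y = min-not-neg (suc k)
          (λ n → subst (ℕ._≤ ℤ.∣ f n ∣) (trans (cong ℤ.∣_∣ x≡-y) (ℤ.∣-i∣≡∣i∣ (f (suc k)))) (min n))
          (pos-neg k 0<x)
        ... | no x≢-y = Pos-irrefl
          (λ m → solve 5 (λ r s x y z →
              con 1ℚ :- (r :* x :+ s :* y :+ z) :+ (z :- x) :+ (:- s) :* (:- (x :+ y) :- con 1ℚ)
                :+ (r :- s :+ con 1ℚ) :* x :+ (:- con 1ℚ :- s)
                := con 0ℚ) refl
            (seq r₀ m) (seq r₁ m) (f k ℚ./ 1) (f (suc k) ℚ./ 1) (f (suc (suc k)) ℚ./ 1))
          (residual<1 (smallResidual orb) k
            ⊞ fromℤ-mono (proj₁ (∣∣≤-nonNeg (f k) (f (suc (suc k))) (ℤ.<⇒≤ (neg-pos (suc k) y<0)) (min (suc (suc k)))))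
            ⊞ r₁≤0 ⊗ fromℤ-<neg (ℤ.≤∧≢⇒< (proj₂ (∣∣≤-nonPos (f k) (f (suc k)) (ℤ.<⇒≤ y<0) (min (suc k)))) x≢-y)
            ⊞ Pos⇒NonNeg d ⊗ fromℤ-nonNeg (ℤ.<⇒≤ 0<x) ⊞ [ (λ h → h) , r₁≤-1 ]′ large)
          where
          y<0 : f (suc k) ℤ.< +0
          y<0 = pos-neg k 0<x
          -- By `d`, r₁ < r₀ + 1 ≤ -1.
          r₁≤-1 : NonNeg (- 2ℝ - r₀) × NonNeg (1ℝ + r₁) → NonNeg (- 1ℝ - r₁)
          r₁≤-1 (r₀≤-2 , _) = NonNeg-resp
            (λ m → solve 2 (λ r s → (r :- s :+ con 1ℚ) :+ (:- con 2ℚ :- r) := :- con 1ℚ :- s) refl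
              (seq r₀ m) (seq r₁ m))
            (Pos⇒NonNeg d ⊕ r₀≤-2)

      -- The coefficients r₀, - r₁, 1 of the recurrence for ∣f∣ have sum r₀ - r₁ + 1. If it is
      -- negative, a maximum of ∣f∣ is impossible for either sign of the entry; if positive, a
      -- minimum is.
      not-alternating : (∀ n → f n ≢ +0) → ¬ (Pos (- (r₀ - r₁ + 1ℝ)) ⊎ Pos (r₀ - r₁ + 1ℝ))
      not-alternating f≢0 (inj₁ d) = argmax (periodic-∘ f-per ℤ.∣_∣) ℕ._≤_ ℕ.≤-trans
        (λ x y c → c (ℕ.≤-total x y)) λ (k , max) → f≢0 (suc k) (ℤ.≤-antisym
          (ℤ.≮⇒≥ (max-not-pos d (suc k) max)) (ℤ.≮⇒≥ (max-not-neg d (suc k) max)))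
      not-alternating f≢0 (inj₂ d) = argmax (periodic-∘ f-per ℤ.∣_∣) (flip ℕ._≤_) (flip ℕ.≤-trans)
        (λ x y c → c (ℕ.≤-total y x)) λ (k , min) → f≢0 (suc k) (ℤ.≤-antisym
          (ℤ.≮⇒≥ (min-not-pos d (suc k) min)) (ℤ.≮⇒≥ (min-not-neg d (suc k) min)))

    zero-both-nonPos : Pos (- (r₀ - r₁ + 1ℝ)) ⊎ Pos (r₀ - r₁ + 1ℝ) →
      ∀ {f} → Periodic f → FloorOrbit f → ∀ n → f n ≡ +0
    zero-both-nonPos d {f} f-per orb n = decidable-stable (f n ℤ.≟ +0) λ fn≢0 →
      let small = smallResidual orb
          pos-neg : ∀ k → +0 ℤ.≤ f k → f (suc k) ℤ.< +0
          pos-neg k 0≤x = ℤ.≰⇒> λ 0≤y → fn≢0 (nonNeg-pair⇒zero f-per small k 0≤x 0≤y n)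
          neg-pos : ∀ k → f k ℤ.≤ +0 → +0 ℤ.< f (suc k)
          neg-pos k x≤0 = ℤ.≰⇒> λ y≤0 → fn≢0 (nonPos-pair⇒zero f-per small k x≤0 y≤0 n)
      in not-alternating f-per orb
        (λ k 0<x → pos-neg k (ℤ.<⇒≤ 0<x)) (λ k x<0 → neg-pos k (ℤ.<⇒≤ x<0))
        -- A zero entry has both weak signs, so its successor would be negative and positive at
        -- once.
        (λ k x≡0 → ℤ.<-asym (pos-neg k (ℤ.≤-reflexive (sym x≡0))) (neg-pos k (ℤ.≤-reflexive x≡0))) d

  -- Region (iii)

  -- Once f k > 0 and f (k + 1) ≤ - f k, signs alternate and the moduli grow forever.
  module _ (0≤r₀+r₁ : NonNeg (r₀ + r₁)) (r₀<0 : Pos (- r₀)) (1≤r₁ : NonNeg (r₁ - 1ℝ)) where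

    module _ {f : ℕ → ℤ} (orb : FloorOrbit f) where
      after-max : ∀ k → +0 ℤ.≤ f (suc k) → f k ℤ.≤ f (suc k) → f (suc (suc k)) ℤ.≤ +0
      after-max k 0≤y x≤y = Pos⇒≤0 (Pos-resp
        (λ m → solve 5 (λ r s x y z →
            con 1ℚ :- (r :* x :+ s :* y :+ z) :+ (r :+ s) :* y :+ (:- r) :* (y :- x) := con 1ℚ :- z) refl
          (seq r₀ m) (seq r₁ m) (f k ℚ./ 1) (f (suc k) ℚ./ 1) (f (suc (suc k)) ℚ./ 1))
        (residual<1 (smallResidual orb) k ⊞ 0≤r₀+r₁ ⊗ fromℤ-nonNeg 0≤y ⊞ Pos⇒NonNeg r₀<0 ⊗ fromℤ-mono x≤y))

      -- z ≥ - r₀ x - r₁ y, where - r₀ x > 0 and - r₁ y ≥ - y. The first term supplies the strict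
      -- growth.
      after-pos-nonPos : ∀ k → +0 ℤ.< f k → f (suc k) ℤ.≤ +0 → ℤ.- f (suc k) ℤ.< f (suc (suc k))
      after-pos-nonPos k 0<x y≤0 = Pos⇒neg< (Pos-resp
        (λ m → solve 5 (λ r s x y z →
            :- r :+ (:- r) :* (x :- con 1ℚ) :+ (r :* x :+ s :* y :+ z) :+ (s :- con 1ℚ) :* (:- y)
              := z :+ y) refl
          (seq r₀ m) (seq r₁ m) (f k ℚ./ 1) (f (suc k) ℚ./ 1) (f (suc (suc k)) ℚ./ 1))
        (r₀<0 ⊞ Pos⇒NonNeg r₀<0 ⊗ fromℤ-pos 0<x ⊞ residual≥0 orb k ⊞ 1≤r₁ ⊗ fromℤ-nonPos y≤0))

      after-nonPos-nonNeg : ∀ k → f k ℤ.≤ +0 → +0 ℤ.≤ f (suc k) → f (suc (suc k)) ℤ.≤ ℤ.- f (suc k)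
      after-nonPos-nonNeg k x≤0 0≤y = Pos⇒≤neg (Pos-resp
        (λ m → solve 5 (λ r s x y z →
            con 1ℚ :- (r :* x :+ s :* y :+ z) :+ (s :- con 1ℚ) :* y :+ (:- r) :* (:- x)
              := con 1ℚ :- (z :+ y)) refl
          (seq r₀ m) (seq r₁ m) (f k ℚ./ 1) (f (suc k) ℚ./ 1) (f (suc (suc k)) ℚ./ 1))
        (residual<1 (smallResidual orb) k ⊞ 1≤r₁ ⊗ fromℤ-nonNeg 0≤y ⊞ Pos⇒NonNeg r₀<0 ⊗ fromℤ-nonPos x≤0))

      after-min : ∀ k → f (suc k) ℤ.≤ +0 → f (suc k) ℤ.≤ f k → +0 ℤ.≤ f (suc (suc k))
      after-min k y≤0 y≤x = Pos⇒0≤ (Pos-resp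
        (λ m → solve 5 (λ r s x y z →
            con 1ℚ :+ (r :* x :+ s :* y :+ z) :+ (r :+ s) :* (:- y) :+ (:- r) :* (x :- y) := con 1ℚ :+ z) refl
          (seq r₀ m) (seq r₁ m) (f k ℚ./ 1) (f (suc k) ℚ./ 1) (f (suc (suc k)) ℚ./ 1))
        (residual>-1 (smallResidual orb) k ⊞ 0≤r₀+r₁ ⊗ fromℤ-nonPos y≤0 ⊞ Pos⇒NonNeg r₀<0 ⊗ fromℤ-mono y≤x))

      -- If x > y, then r₀ x < r₀ y, and the residual falls below (r₀ + r₁) y + z ≤ 0.
      before-min : ∀ k → f (suc k) ℤ.≤ +0 → f (suc (suc k)) ℤ.≤ +0 → f k ℤ.≤ f (suc k)
      before-min k y≤0 z≤0 = ℤ.≮⇒≥ λ y<x → Pos-irrefl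
        (λ m → solve 5 (λ r s x y z →
            :- r :+ (:- r) :* (x :- y :- con 1ℚ) :+ (r :* x :+ s :* y :+ z) :+ (:- z) :+ (r :+ s) :* (:- y)
              := con 0ℚ) refl
          (seq r₀ m) (seq r₁ m) (f k ℚ./ 1) (f (suc k) ℚ./ 1) (f (suc (suc k)) ℚ./ 1))
        (r₀<0 ⊞ Pos⇒NonNeg r₀<0 ⊗ fromℤ-mono-< y<x ⊞ residual≥0 orb k ⊞ fromℤ-nonPos z≤0
          ⊞ 0≤r₀+r₁ ⊗ fromℤ-nonPos y≤0)

      Diverging : ℕ → Set
      Diverging k = +0 ℤ.< f k × f (suc k) ℤ.≤ ℤ.- f k

      diverging⇒< : ∀ k → Diverging k → f k ℤ.< f (suc (suc k))
      diverging⇒< k (0<x , y≤-x) = ℤ.≤-<-trans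
        (subst (ℤ._≤ ℤ.- f (suc k)) (ℤ.neg-involutive (f k)) (ℤ.neg-mono-≤ y≤-x))
        (after-pos-nonPos k 0<x (ℤ.≤-trans y≤-x (ℤ.neg-mono-≤ (ℤ.<⇒≤ 0<x))))

      pos-nonPos⇒diverging : ∀ k → +0 ℤ.< f k → f (suc k) ℤ.≤ +0 → Diverging (suc (suc k))
      pos-nonPos⇒diverging k 0<x y≤0 = 0<z , after-nonPos-nonNeg (suc k) y≤0 (ℤ.<⇒≤ 0<z)
        where
        0<z : +0 ℤ.< f (suc (suc k))
        0<z = ℤ.≤-<-trans (ℤ.neg-mono-≤ y≤0) (after-pos-nonPos k 0<x y≤0)

      diverging-forever : ∀ k → Diverging k → ∀ j → Diverging (j ℕ.* 2 ℕ.+ k)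
      diverging-forever k dv zero    = dv
      diverging-forever k dv (suc j) = let 0<x , y≤-x = diverging-forever k dv j in
        pos-nonPos⇒diverging (j ℕ.* 2 ℕ.+ k) 0<x (ℤ.≤-trans y≤-x (ℤ.neg-mono-≤ (ℤ.<⇒≤ 0<x)))

      -- Every second entry from `k` on strictly increases, yet these entries form a periodic
      -- sequence, with period `suc q` in their own index, and so attain a maximum.
      ¬diverging : Periodic f → ∀ k → ¬ Diverging k
      ¬diverging f-per@(q , _) k dv =
        ℤ-argmax {λ j → f (j ℕ.* 2 ℕ.+ k)} (q , λ j → trans (cong f (double j)) (periodic-* f-per 2 (j ℕ.* 2 ℕ.+ k)))
          λ (j , max) → ℤ.<⇒≱ (diverging⇒< (suc j ℕ.* 2 ℕ.+ k) (diverging-forever k dv (suc j))) (max (suc (suc j)))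
        where
        double : ∀ j → (j ℕ.+ suc q) ℕ.* 2 ℕ.+ k ≡ j ℕ.* 2 ℕ.+ k ℕ.+ 2 ℕ.* suc q
        double j = begin
          (j ℕ.+ suc q) ℕ.* 2 ℕ.+ k        ≡⟨ cong (ℕ._+ k) (ℕ.*-distribʳ-+ 2 j (suc q)) ⟩
          j ℕ.* 2 ℕ.+ suc q ℕ.* 2 ℕ.+ k    ≡⟨ shift-comm (j ℕ.* 2) (suc q ℕ.* 2) k ⟩
          j ℕ.* 2 ℕ.+ k ℕ.+ suc q ℕ.* 2    ≡⟨ cong (j ℕ.* 2 ℕ.+ k ℕ.+_) (ℕ.*-comm (suc q) 2) ⟩
          j ℕ.* 2 ℕ.+ k ℕ.+ 2 ℕ.* suc q    ∎
          where open ≡-Reasoning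

    zero-r₁≥1 : ∀ {f} → Periodic f → FloorOrbit f → ∀ n → f n ≡ +0
    zero-r₁≥1 {f} f-per@(q , f-per′) orb n = ℤ.≤-antisym (f≤0 n) (min-principle f-per 0≤min n)
      where
      f≤0 : ∀ n → f n ℤ.≤ +0
      f≤0 = max-principle f-per λ k max 0≤max → ℤ.≮⇒≥ λ 0<max →
        ¬diverging orb f-per (suc (suc (suc k)))
          (pos-nonPos⇒diverging orb (suc k) 0<max (after-max orb k 0≤max (max k)))
      0≤min : ∀ k → (∀ n → f (suc k) ℤ.≤ f n) → f (suc k) ℤ.≤ +0 → +0 ℤ.≤ f (suc k)
      -- One period on, the minimum has two entries before it. By `before-min` its predecessor is
      -- minimal too, so `after-min`, applied to that predecessor, makes the minimum nonnegative.
      0≤min k min _ = ℤ.≤-trans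
        (after-min orb (k ℕ.+ q) (f≤0 _)
          (ℤ.≤-trans (before-min orb (suc (k ℕ.+ q)) (f≤0 _) (f≤0 _)) (ℤ.≤-trans (ℤ.≤-reflexive k+) (min _))))
        (ℤ.≤-reflexive k+)
        where
        k+ : f (suc (suc (k ℕ.+ q))) ≡ f (suc k)
        k+ = trans (cong (λ t → f (suc t)) (sym (ℕ.+-suc k q))) (f-per′ (suc k))

  -- From orbits to the recurrence, and assembly of the regions

  isOrbit⇒floorOrbit : ∀ {a} → IsOrbit (r₀ , r₁) a → ∀ k → FloorOrbit (λ n → a (n ℕ.+ k))
  isOrbit⇒floorOrbit {a} orbit k = record
    { residual≥0    = res≥0
    ; smallResidual = record { residual>-1 = λ n → 1-pos ⊞ res≥0 n ; residual<1 = res<1 }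
    }
    where
    f : ℕ → ℤ
    f n = a (n ℕ.+ k)
    -- The new entry is `- v` with `v` the floor of r₀ a + r₁ b, so the residual is the fractional
    -- part of that number.
    res≥0 : ∀ n → NonNeg (residual f n)
    res≥0 n with orbit (n ℕ.+ k)
    ... | _ , v , (v≤x , _) , z≡-v = NonNeg-resp
      (λ m → cong (λ t → seq r₀ m ℚ.* (f n ℚ./ 1) ℚ.+ seq r₁ m ℚ.* (f (suc n) ℚ./ 1) ℚ.+ t)
        (sym (trans (cong (ℚ._/ 1) z≡-v) (/1-neg v))))
      (≤⇒NonNeg (fromℤ v) (r₀ * fromℤ (f n) + r₁ * fromℤ (f (suc n))) v≤x)
    res<1 : ∀ n → Pos (1ℝ - residual f n)
    res<1 n with orbit (n ℕ.+ k)
    ... | _ , v , (_ , x<1+v) , z≡-v = Pos-resp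
      (λ m → let x = seq r₀ m ℚ.* (f n ℚ./ 1) ℚ.+ seq r₁ m ℚ.* (f (suc n) ℚ./ 1) in trans
        (cong (ℚ._- x) (/1-+ v (+ 1)))
        (trans (solve 2 (λ v x → (v :+ con 1ℚ) :- x := con 1ℚ :- (x :- v)) refl (v ℚ./ 1) x)
          (cong (λ t → 1ℚ ℚ.- (x ℚ.+ t)) (sym (trans (cong (ℚ._/ 1) z≡-v) (/1-neg v))))))
      (<⇒Pos (r₀ * fromℤ (f n) + r₁ * fromℤ (f (suc n))) (fromℤ (v ℤ.+ + 1)) x<1+v)

  ≉-1⇒apart : ¬ (r₀ - r₁ ≈ - 1ℝ) → ¬ ¬ (Pos (- (r₀ - r₁ + 1ℝ)) ⊎ Pos (r₀ - r₁ + 1ℝ))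
  ≉-1⇒apart r₀-r₁≉-1 c = r₀-r₁≉-1 (≤-antisym (r₀ - r₁) (- 1ℝ)
    (NonNeg⇒≤ (r₀ - r₁) (- 1ℝ) (¬Pos⇒NonNeg λ h → c (inj₂ (Pos-resp
      (λ m → solve 2 (λ r s → :- (:- con 1ℚ :- (r :- s)) := r :- s :+ con 1ℚ) refl (seq r₀ m) (seq r₁ m)) h))))
    (NonNeg⇒≤ (- 1ℝ) (r₀ - r₁) (¬Pos⇒NonNeg λ h → c (inj₁ (Pos-resp
      (λ m → solve 2 (λ r s → :- ((r :- s) :- :- con 1ℚ) := :- (r :- s :+ con 1ℚ)) refl (seq r₀ m) (seq r₁ m)) h)))))

  ¬box⇒large : ¬ (- 2ℝ < r₀ × - 1ℝ < r₁) →
    ¬ ¬ (NonNeg (- 1ℝ - r₁) ⊎ (NonNeg (- 2ℝ - r₀) × NonNeg (1ℝ + r₁)))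
  ¬box⇒large ¬box c = dichotomy (- 1ℝ - r₁) λ where
    (inj₁ h) → c (inj₁ h)
    (inj₂ h) → c (inj₂
      -- If r₀ > -2, being outside the box forces r₁ ≤ -1, the alternative handed to `c`.
      ( ¬Pos⇒NonNeg (λ -2<r₀ → c (inj₁ (¬Pos⇒NonNeg λ -1<r₁ → ¬box
          ( Pos⇒< (- 2ℝ) r₀ (Pos-resp (λ m → solve 1 (λ r → :- (:- con 2ℚ :- r) := r :- :- con 2ℚ) refl (seq r₀ m)) -2<r₀)
          , Pos⇒< (- 1ℝ) r₁ (Pos-resp (λ m → solve 1 (λ s → :- (:- con 1ℚ :- s) := s :- :- con 1ℚ) refl (seq r₁ m)) -1<r₁)))))
      , NonNeg-resp (λ m → solve 1 (λ s → :- (:- con 1ℚ :- s) := con 1ℚ :+ s) refl (seq r₁ m)) h))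

  -- The characteristic polynomial X² + r₁ X + r₀ is at most -1 at 1. The sign distinctions on `r₀`
  -- and `r₁` hold only doubly negated, so they are made while refuting `f n ≢ +0`.
  zero-negative-at-1 : r₀ + r₁ ≤ - 2ℝ → ¬ (r₀ - r₁ ≈ - 1ℝ) → ¬ (- 2ℝ < r₀ × - 1ℝ < r₁) →
    ∀ {f} → Periodic f → FloorOrbit f → ∀ n → f n ≡ +0
  zero-negative-at-1 r₀+r₁≤-2 r₀-r₁≉-1 ¬box {f} f-per orb n = decidable-stable (f n ℤ.≟ +0) λ fn≢0 →
    dichotomy r₀ λ where
      (inj₁ 0≤r₀) → fn≢0 (nonPos⇒zero (nonPos-r₁ 0≤r₀ sum) f-per orb n)
      (inj₂ r₀≤0) → dichotomy r₁ λ where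
        (inj₁ 0≤r₁) → fn≢0 (nonPos⇒zero (nonPos-r₀ 0≤r₁ sum) f-per orb n)
        (inj₂ r₁≤0) → ¬box⇒large ¬box λ large → ≉-1⇒apart r₀-r₁≉-1 λ d →
          fn≢0 (zero-both-nonPos r₀≤0 r₁≤0 sum large d f-per orb n)
    where
    sum : NonNeg (- 2ℝ - (r₀ + r₁))
    sum = ≤⇒NonNeg (r₀ + r₁) (- 2ℝ) r₀+r₁≤-2

  -- Dropping the first `n₀` entries makes the orbit periodic from index 0.
  zero⇒𝒟₂⁽*⁾ : (∀ {f} → Periodic f → FloorOrbit f → ∀ n → f n ≡ +0) → 𝒟₂⁽*⁾ (r₀ , r₁)
  zero⇒𝒟₂⁽*⁾ vanish a orbit (n₀ , suc q , _ , a-per) = n₀ , λ n n₀≤n →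
    subst (λ t → a t ≡ +0) (ℕ.m∸n+n≡m n₀≤n)
      (vanish {λ m → a (m ℕ.+ n₀)} (q , f-per) (isOrbit⇒floorOrbit {a} orbit n₀) (n ℕ.∸ n₀))
    where
    f-per : ∀ m → a (m ℕ.+ suc q ℕ.+ n₀) ≡ a (m ℕ.+ n₀)
    f-per m = trans (cong a (shift-comm m (suc q) n₀)) (a-per (m ℕ.+ n₀) (ℕ.m≤n+m n₀ m))

theorem3 : (r₀ r₁ : ℝ) →
    ( (0ℝ < r₀ × (Σ[ s ∈ ℝ ] (IsSqrt r₀ s × r₁ ≤ - (2ℝ * s))) × 0ℝ ≤ r₀ + r₁)
    ⊎ (((r₀ + r₁ ≤ - 2ℝ) × ¬ (r₀ - r₁ ≈ - 1ℝ)) × ¬ (- 2ℝ < r₀ × - 1ℝ < r₁))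
    ⊎ (0ℝ ≤ r₀ + r₁ × r₀ < 0ℝ × 1ℝ ≤ r₁) ) →
    𝒟₂⁽*⁾ (r₀ , r₁)
theorem3 r₀ r₁ (inj₁ (0<r₀ , (s , (0≤s , s²≈r₀) , r₁≤-2s) , 0≤r₀+r₁)) =
  zero⇒𝒟₂⁽*⁾ (nonPos⇒zero (nonPos-real-roots s (nonNeg 0≤s) (≤⇒NonNeg r₀ (s * s) (≈⇒≥ (s * s) r₀ s²≈r₀)) (pos 0<r₀)
    (≤⇒NonNeg r₁ (- (2ℝ * s)) r₁≤-2s) (nonNeg 0≤r₀+r₁)))
  where open Recurrence r₀ r₁
theorem3 r₀ r₁ (inj₂ (inj₁ ((r₀+r₁≤-2 , r₀-r₁≉-1) , ¬box))) =
  zero⇒𝒟₂⁽*⁾ (zero-negative-at-1 r₀+r₁≤-2 r₀-r₁≉-1 ¬box)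
  where open Recurrence r₀ r₁
theorem3 r₀ r₁ (inj₂ (inj₂ (0≤r₀+r₁ , r₀<0 , 1≤r₁))) =
  zero⇒𝒟₂⁽*⁾ (zero-r₁≥1 (nonNeg 0≤r₀+r₁)
    (Pos-resp (λ m → ℚ.+-identityˡ (ℚ.- seq r₀ m)) (<⇒Pos r₀ 0ℝ r₀<0)) (≤⇒NonNeg 1ℝ r₁ 1≤r₁))
  where open Recurrence r₀ r₁
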